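{- Let $m,n\ge1$ and $V=\mathbb C^{m+1}$ with the standard volume form $\langle u_1,\dots,u_{m+1}\rangle=\det(u_1,\dots,u_{m+1})$. Consider the coordinate ring of $V^{2n}\times SL(V)$, with points $(v_1,\dots,v_n,w_1,\dots,w_n,A)$. Extend the indices to all of $\mathbb Z$ by $v_{k+n}=Av_k$ and $w_{k+n}=Aw_k$ for all $k\in\mathbb Z$. The following $2mn+2n$ polynomial functions, all lying in the ring $\mathbb C[V^{2n}\times SL(V)]^{SL(V)}$ of $SL(V)$-invariants (with $SL(V)$ acting on vectors and on itself by conjugation), are algebraically independent over $\mathbb C$: (a) $\langle v_i,v_{i+1},\dots,v_{i+m}\rangle$ for $i=1,\dots,n$; (b) $\langle w_i,w_{i-1},\dots,w_{i-m}\rangle$ for $i=1,\dots,n$; (c) $\langle v_i,\dots,v_{i+\alpha-1},w_i,w_{i-1},\dots,w_{i-\beta+1}\rangle$ for $i=1,\dots,n$ and $\alpha+\beta=m+1$, $\alpha,\beta\ge1$; (d) $\langle v_i,\dots,v_{i+\alpha-1},w_{i-1},w_{i-2},\dots,w_{i-\beta}\rangle$ for $i=1,\dots,n$ and $\alpha+\beta=m+1$, $\alpha,\beta\ge1$.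
   Context: $SL(V)$ acts on $V$ naturally and on $SL(V)$ by conjugation; all the listed functions are invariant under the induced action. Here $\langle\cdot\rangle$ denotes the determinant of the matrix whose columns are the listed $m+1$ vectors. -}

module Defs where

open import Level using (Level; _⊔_; Lift)
open import Data.Unit using (⊤)
open import Algebra.Bundles using (CommutativeRing)
open import Data.Nat as ℕ using (ℕ; zero; suc; NonZero)
open import Data.Nat.Properties using (≤∧≢⇒<)
open import Data.Integer as ℤ using (ℤ; +_; -[1+_])
open import Data.Integer.DivMod using (_/ℕ_; _%ℕ_; n%ℕd<d)
open import Data.Fin as Fin using (Fin; toℕ; punchIn; fromℕ<)
open import Data.Vec as Vec using (Vec; []; _∷_; _++_; concat; tabulate)
open import Data.List using (List; []; _∷_)
open import Data.Bool using (if_then_else_)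
open import Data.Product using (Σ; ∃; _×_; _,_)
open import Relation.Nullary using (¬_)

module Over {c ℓ : Level} (R : CommutativeRing c ℓ) where
  open CommutativeRing R

  K : Set c
  K = Carrier

  ℕ→K : ℕ → K
  ℕ→K zero    = 0#
  ℕ→K (suc k) = 1# + ℕ→K k

  pow : K → ℕ → K
  pow x zero    = 1#
  pow x (suc k) = x * pow x k

  ΣFin : (k : ℕ) → (Fin k → K) → K
  ΣFin zero    f = 0#
  ΣFin (suc k) f = f Fin.zero + ΣFin k (λ i → f (Fin.suc i))

  monicEval : (d : ℕ) → (Fin (suc d) → K) → K → K
  monicEval d cs x = pow x (suc d) + ΣFin (suc d) (λ i → cs i * pow x (toℕ i))

  record IsAlgClosedFieldChar0 : Set (c ⊔ ℓ) where
    field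
      nontrivial  : ¬ (1# ≈ 0#)
      inverse     : ∀ x → ¬ (x ≈ 0#) → ∃ λ y → x * y ≈ 1#
      char0       : ∀ k → ¬ (ℕ→K (suc k) ≈ 0#)
      algClosed   : ∀ d (cs : Fin (suc d) → K) → ∃ λ x → monicEval d cs x ≈ 0#

  Vect : ℕ → Set c
  Vect k = Fin k → K

  Mat : ℕ → Set c
  Mat k = Fin k → Fin k → K

  sign : ℕ → K → K
  sign zero    x = x
  sign (suc j) x = - (sign j x)

  det : (k : ℕ) → Mat k → K
  det zero    M = 1#
  det (suc k) M =
    ΣFin (suc k) (λ j → sign (toℕ j)
      (M Fin.zero j * det k (λ r s → M (Fin.suc r) (punchIn j s))))

  bracket : (k : ℕ) → (Fin k → Vect k) → K
  bracket k u = det k (λ r col → u col r)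

  _·ᵥ_ : {k : ℕ} → Mat k → Vect k → Vect k
  (A ·ᵥ u) r = ΣFin _ (λ s → A r s * u s)

  idMat : (k : ℕ) → Mat k
  idMat k r s = if toℕ r ℕ.≡ᵇ toℕ s then 1# else 0#

  _·ₘ_ : {k : ℕ} → Mat k → Mat k → Mat k
  (A ·ₘ B) r s = ΣFin _ (λ t → A r t * B t s)

  -- Points of V^{2n} × SL(V), V = K^{m+1}.  The inverse matrix Ainv is
  -- carried along (it is uniquely determined by A), so that negative
  -- powers of A can be written without division.

  _≡ₘ_ : {k : ℕ} → Mat k → Mat k → Set ℓ
  M ≡ₘ N = ∀ r s → M r s ≈ N r s

  record Point (m n : ℕ) : Set (c ⊔ ℓ) where
    field
      v    : Fin n → Vect (suc m)
      w    : Fin n → Vect (suc m)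
      A    : Mat (suc m)
      Ainv : Mat (suc m)
      detA : det (suc m) A ≈ 1#
      invA : (A ·ₘ Ainv) ≡ₘ idMat (suc m)

  iter : {k : ℕ} → Mat k → ℕ → Vect k → Vect k
  iter M zero    u = u
  iter M (suc q) u = M ·ᵥ iter M q u

  powAct : ∀ {m n} → Point m n → ℤ → Vect (suc m) → Vect (suc m)
  powAct p (+ q)     u = iter (Point.A p) q u
  powAct p -[1+ q ]  u = iter (Point.Ainv p) (suc q) u

  -- Extension of 1-based indices to ℤ:  x_{k+n} = A x_k.
  -- For k ∈ ℤ write k - 1 = q n + r with 0 ≤ r < n; then x_k = A^q x_{r+1}.
  extend : ∀ {m n} .{{_ : NonZero n}} → Point m n → (Fin n → Vect (suc m))
         → ℤ → Vect (suc m)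
  extend {n = n} p x k =
    powAct p ((k ℤ.- ℤ.1ℤ) /ℕ n) (x (fromℕ< (n%ℕd<d (k ℤ.- ℤ.1ℤ) n)))

  vAt wAt : ∀ {m n} .{{_ : NonZero n}} → Point m n → ℤ → Vect (suc m)
  vAt p = extend p (Point.v p)
  wAt p = extend p (Point.w p)

  -- The invariants (a)–(d).  For i : Fin n the paper's index is toℕ i + 1.
  -- In (c),(d) α = toℕ a + 1 with a : Fin m (so 1 ≤ α ≤ m, β = m + 1 - α ≥ 1).

  idx : ∀ {n} → Fin n → ℤ
  idx i = + suc (toℕ i)

  fa : ∀ m {n} .{{_ : NonZero n}} → Fin n → Point m n → K
  fa m i p = bracket (suc m) (λ col → vAt p (idx i ℤ.+ + toℕ col))

  fb : ∀ m {n} .{{_ : NonZero n}} → Fin n → Point m n → K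
  fb m i p = bracket (suc m) (λ col → wAt p (idx i ℤ.- + toℕ col))

  fc : ∀ m {n} .{{_ : NonZero n}} → Fin n → Fin m → Point m n → K
  fc m i a p = bracket (suc m) (λ col →
    if toℕ col ℕ.≤ᵇ toℕ a
      then vAt p (idx i ℤ.+ + toℕ col)
      else wAt p (idx i ℤ.- (+ toℕ col ℤ.- + suc (toℕ a))))

  fd : ∀ m {n} .{{_ : NonZero n}} → Fin n → Fin m → Point m n → K
  fd m i a p = bracket (suc m) (λ col →
    if toℕ col ℕ.≤ᵇ toℕ a
      then vAt p (idx i ℤ.+ + toℕ col)
      else wAt p (idx i ℤ.- ℤ.1ℤ ℤ.- (+ toℕ col ℤ.- + suc (toℕ a))))

  generators : ∀ m n .{{_ : NonZero n}} →
               Vec (Point m n → K) (n ℕ.+ (n ℕ.+ (n ℕ.* m ℕ.+ n ℕ.* m)))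
  generators m n =
    tabulate (fa m) ++ tabulate (fb m)
      ++ concat (tabulate (λ i → tabulate (fc m i)))
      ++ concat (tabulate (λ i → tabulate (fd m i)))

  -- Polynomials in k variables with coefficients in K, as iterated
  -- univariate coefficient lists:  Poly (suc k) = (Poly k)[x_0].

  Poly : ℕ → Set c
  Poly zero    = K
  Poly (suc k) = List (Poly k)

  evalPoly : ∀ {k} → Poly k → Vec K k → K
  evalPoly {zero}  p        []       = p
  evalPoly {suc k} []       (x ∷ xs) = 0#
  evalPoly {suc k} (q ∷ qs) (x ∷ xs) = evalPoly {k} q xs + x * evalPoly {suc k} qs (x ∷ xs)

  IsZeroPoly : ∀ {k} → Poly k → Set ℓ
  IsZeroPoly {zero}  p  = p ≈ 0#
  IsZeroPoly {suc k} []       = Lift ℓ ⊤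
  IsZeroPoly {suc k} (q ∷ qs) = IsZeroPoly {k} q × IsZeroPoly {suc k} qs

  AlgIndependent : ∀ {a} {X : Set a} {k : ℕ} → Vec (X → K) k → Set (a ⊔ c ⊔ ℓ)
  AlgIndependent {X = X} {k} fs =
    ∀ (P : Poly k) → (∀ (x : X) → evalPoly {k} P (Vec.map (λ f → f x) fs) ≈ 0#)
      → IsZeroPoly {k} P

{-# OPTIONS --safe #-}

-- Every assignment of nonzero values to the functions (a)–(d) is attained at some
-- point, so a polynomial relation between them vanishes at all tuples of positive
-- integers, and in characteristic 0 it is the zero polynomial.
--
-- To attain given values, let F_i be the flag of v_i, v_{i+1}, … and G_i the flag of
-- w_i, w_{i-1}, …, and choose frames E_i adapted to (F_i, G_{i-1}) and E′_i adapted
-- to (F_i, G_i).  Since F_{i+1} and F_i (and G_i and G_{i-1}) are interleaved,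
-- E_i = E′_i U_i and E_{i+1} = E′_i L_i with U_i upper and L_i lower bidiagonal, and
-- all brackets are products of entries of these matrices.  Conversely the values
-- determine n-periodic U_i and L_i by explicit ratios, and A = E_n E_0⁻¹ is the
-- monodromy of the resulting sequence of frames.
module Submission where

open import Defs
open import Level using (Level; _⊔_; lift)
open import Algebra.Bundles using (CommutativeRing)
open import Data.Nat as ℕ using (ℕ; zero; suc; _≤_; NonZero; >-nonZero)
open import Data.Fin as Fin using (Fin; zero; suc; toℕ; punchIn)
open import Data.Fin.Properties using (toℕ-fromℕ; toℕ-injective; toℕ-fromℕ<; toℕ<n)
import Data.Nat.Properties as ℕ
open import Data.Empty using (⊥-elim)
open import Data.List as List using (List; []; _∷_; length)
open import Data.List.Relation.Unary.All as All using (All; []; _∷_)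
open import Data.Vec as Vec using (Vec; []; _∷_)
open import Data.Vec.Relation.Binary.Pointwise.Inductive as Pointwise using (Pointwise; []; _∷_)
open import Data.Bool using (true; false; if_then_else_)
open import Data.Integer as ℤ using (ℤ; +_; -[1+_])
open import Data.Integer.DivMod using (_/ℕ_; _%ℕ_; n%ℕd<d; a≡a%ℕn+[a/ℕn]*n)
import Data.Integer.Properties as ℤ
open import Data.Integer.Solver using (module +-*-Solver)
open import Data.Product using (∃; _×_; _,_; proj₁; proj₂)
open import Function using (_∘_)
open import Relation.Binary.PropositionalEquality as ≡ using (_≡_; _≢_)
import Algebra.Properties.Ring
import Algebra.Solver.Ring.NaturalCoefficients.Default
import Relation.Binary.Reasoning.Setoid

-- An adapted frame is determined only up to scaling its vectors. That freedom is spent on giving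
-- U_i diagonal 1 and L_i subdiagonal 1: then every v has leading coefficient 1, and a bracket is
-- the determinant of its frame times the leading coefficients of the vectors w in it, up to sign.
-- The brackets with b and b + 1 vectors w therefore force the leading coefficient of w_{i-b} to be
-- their quotient up to sign, and comparing these coefficients in E_i, E′_i and E_{i+1} gives the
-- remaining entries of U_i and L_i. Types (a) and (b) are the extreme cases β = 0 and β = m + 1 of
-- both (c) and (d). These overlaps make the determinants of successive frames match the prescribed
-- values of (a), and periodicity then gives the monodromy determinant 1. Since the construction
-- runs from values to frames, every map is a product of elementary ones with explicit inverse and
-- determinant.

-- Integer indices and their residues modulo `n`

ℤ-induction : ∀ {p} (P : ℤ → Set p) → P (+ 0) → (∀ i → P i → P (ℤ.suc i)) →
              (∀ i → P (ℤ.suc i) → P i) → ∀ i → P i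
ℤ-induction P P0 up down (+ zero)       = P0
ℤ-induction P P0 up down (+ suc q)      = up (+ q) (ℤ-induction P P0 up down (+ q))
ℤ-induction P P0 up down -[1+ zero ]    = down -[1+ 0 ] P0
ℤ-induction P P0 up down -[1+ suc q ]   = down -[1+ suc q ] (ℤ-induction P P0 up down -[1+ q ])

+[a+b]-+a≡+b : ∀ a b → + (a ℕ.+ b) ℤ.- + a ≡ + b
+[a+b]-+a≡+b a b = ≡.trans (≡.cong (ℤ._- + a) (ℤ.pos-+ a b))
  (solve 2 (λ a b → (a :+ b) :- a := b) ≡.refl (+ a) (+ b))
  where open +-*-Solver

-- r : Fin n stands for the paper's index toℕ r + 1, hence the shift by 1.
residue : ∀ n .{{_ : NonZero n}} → ℤ → Fin n
residue n k = Fin.fromℕ< (n%ℕd<d (k ℤ.- ℤ.1ℤ) n)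

-- The difference of the two remainders is a multiple of `n` of absolute value below `n`, so the
-- multiplier is 0.
remainder-unique : ∀ n r r′ q q′ → r ℕ.< n → r′ ℕ.< n →
                   + r ℤ.+ q ℤ.* + n ≡ + r′ ℤ.+ q′ ℤ.* + n → r ≡ r′
remainder-unique n r r′ q q′ r<n r′<n e = ℤ.+-injective (ℤ.i-j≡0⇒i≡j (+ r) (+ r′) diff≡0)
  where
  diff : + r ℤ.- + r′ ≡ (q′ ℤ.- q) ℤ.* + n
  diff = ≡.trans
    (solve 5 (λ r r′ q q′ n → r :- r′ := (r :+ q :* n) :- (r′ :+ q′ :* n) :+ (q′ :- q) :* n)
      ≡.refl (+ r) (+ r′) q q′ (+ n))
    (≡.trans (≡.cong (ℤ._+ (q′ ℤ.- q) ℤ.* + n) (ℤ.i≡j⇒i-j≡0 e)) (ℤ.+-identityˡ _))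
    where open +-*-Solver
  small : ℤ.∣ q′ ℤ.- q ∣ ℕ.* n ℕ.< 1 ℕ.* n
  small = ≡.subst₂ ℕ._<_
    (≡.trans (≡.cong ℤ.∣_∣ (≡.trans (≡.sym (ℤ.[+m]-[+n]≡m⊖n r r′)) diff)) (ℤ.abs-* (q′ ℤ.- q) (+ n)))
    (≡.sym (ℕ.*-identityˡ n))
    (ℕ.≤-<-trans (ℤ.∣m⊝n∣≤m⊔n r r′) (ℕ.⊔-lub r<n r′<n))
  diff≡0 : + r ℤ.- + r′ ≡ ℤ.0ℤ
  diff≡0 = ≡.trans diff (≡.cong (ℤ._* + n) {q′ ℤ.- q} {ℤ.0ℤ}
    (ℤ.∣i∣≡0⇒i≡0 {q′ ℤ.- q} (ℕ.n<1⇒n≡0 (ℕ.*-cancelʳ-< n ℤ.∣ q′ ℤ.- q ∣ 1 small))))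

module _ (n : ℕ) .{{_ : NonZero n}} where
  residue-unique : ∀ k (r : Fin n) q → k ≡ + suc (toℕ r) ℤ.+ q ℤ.* + n → residue n k ≡ r
  residue-unique k r q k≡ = toℕ-injective (≡.trans (toℕ-fromℕ< _) (remainder-unique n _ (toℕ r)
    ((k ℤ.- ℤ.1ℤ) /ℕ n) q (n%ℕd<d (k ℤ.- ℤ.1ℤ) n) (toℕ<n r)
    (≡.trans (≡.sym (a≡a%ℕn+[a/ℕn]*n (k ℤ.- ℤ.1ℤ) n)) (≡.trans (≡.cong (ℤ._- ℤ.1ℤ) k≡)
      (solve 2 (λ r qn → (con ℤ.1ℤ :+ r :+ qn) :- con ℤ.1ℤ := r :+ qn) ≡.refl (+ toℕ r) (q ℤ.* + n))))))
    where open +-*-Solver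

  residue-quotient : ∀ k → k ≡ + suc (toℕ (residue n k)) ℤ.+ ((k ℤ.- ℤ.1ℤ) /ℕ n) ℤ.* + n
  residue-quotient k = ≡.trans
    (solve 1 (λ k → k := con ℤ.1ℤ :+ (k :- con ℤ.1ℤ)) ≡.refl k)
    (≡.trans (≡.cong (ℤ._+_ ℤ.1ℤ) (a≡a%ℕn+[a/ℕn]*n (k ℤ.- ℤ.1ℤ) n))
      (≡.trans (≡.sym (ℤ.+-assoc ℤ.1ℤ (+ r) (q ℤ.* + n)))
        (≡.cong (λ s → + suc s ℤ.+ q ℤ.* + n) (≡.sym (toℕ-fromℕ< (n%ℕd<d (k ℤ.- ℤ.1ℤ) n))))))
    where
    open +-*-Solver
    r = (k ℤ.- ℤ.1ℤ) %ℕ n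
    q = (k ℤ.- ℤ.1ℤ) /ℕ n

  residue-idx : ∀ (r : Fin n) → residue n (+ suc (toℕ r)) ≡ r
  residue-idx r = residue-unique (+ suc (toℕ r)) r ℤ.0ℤ (≡.sym (ℤ.+-identityʳ _))

  residue-+n : ∀ k → residue n (k ℤ.+ + n) ≡ residue n k
  residue-+n k = residue-unique (k ℤ.+ + n) (residue n k) (ℤ.1ℤ ℤ.+ (k ℤ.- ℤ.1ℤ) /ℕ n)
    (≡.trans (≡.cong (ℤ._+ + n) (residue-quotient k))
      (solve 3 (λ r q n → (r :+ q :* n) :+ n := r :+ (con ℤ.1ℤ :+ q) :* n) ≡.refl
        (+ suc (toℕ (residue n k))) ((k ℤ.- ℤ.1ℤ) /ℕ n) (+ n)))
    where open +-*-Solver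

module Theory {c ℓ : Level} (R : CommutativeRing c ℓ) where
  open CommutativeRing R hiding (zero)
  open Over R
  open Algebra.Properties.Ring ring
    using (-‿distribˡ-*; -‿distribʳ-*; -‿+-comm; -0#≈0#; -‿involutive)
  private module ℤS = +-*-Solver
  open Algebra.Solver.Ring.NaturalCoefficients.Default commutativeSemiring
    using (solve; _:=_; _:+_; _:*_; con)
  open Relation.Binary.Reasoning.Setoid setoid

  -- Determinants

  ΣFin-cong : ∀ k {f g : Fin k → K} → (∀ i → f i ≈ g i) → ΣFin k f ≈ ΣFin k g
  ΣFin-cong zero    f≈g = refl
  ΣFin-cong (suc k) f≈g = +-cong (f≈g zero) (ΣFin-cong k (f≈g ∘ suc))

  ΣFin-zero : ∀ k {f : Fin k → K} → (∀ i → f i ≈ 0#) → ΣFin k f ≈ 0#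
  ΣFin-zero zero    f≈0 = refl
  ΣFin-zero (suc k) f≈0 = trans (+-cong (f≈0 zero) (ΣFin-zero k (f≈0 ∘ suc))) (+-identityˡ 0#)

  ΣFin-+ : ∀ k (f g : Fin k → K) → ΣFin k (λ i → f i + g i) ≈ ΣFin k f + ΣFin k g
  ΣFin-+ zero    f g = sym (+-identityˡ 0#)
  ΣFin-+ (suc k) f g = trans (+-congˡ (ΣFin-+ k (f ∘ suc) (g ∘ suc)))
    (solve 4 (λ a b s t → (a :+ b) :+ (s :+ t) := (a :+ s) :+ (b :+ t)) refl _ _ _ _)

  ΣFin-*ˡ : ∀ k x (f : Fin k → K) → ΣFin k (λ i → x * f i) ≈ x * ΣFin k f
  ΣFin-*ˡ zero    x f = sym (zeroʳ x)
  ΣFin-*ˡ (suc k) x f = trans (+-congˡ (ΣFin-*ˡ k x (f ∘ suc))) (sym (distribˡ x _ _))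

  ΣFin-neg : ∀ k (f : Fin k → K) → ΣFin k (λ i → - f i) ≈ - ΣFin k f
  ΣFin-neg zero    f = sym -0#≈0#
  ΣFin-neg (suc k) f = trans (+-congˡ (ΣFin-neg k (f ∘ suc))) (-‿+-comm _ _)

  ΣFin-last : ∀ k (f : Fin (suc k) → K) → (∀ i → toℕ i ℕ.< k → f i ≈ 0#) →
              ΣFin (suc k) f ≈ f (Fin.fromℕ k)
  ΣFin-last zero    f f≈0 = +-identityʳ _
  ΣFin-last (suc k) f f≈0 = trans
    (+-cong (f≈0 zero (ℕ.s≤s ℕ.z≤n)) (ΣFin-last k (f ∘ suc) λ i i<k → f≈0 (suc i) (ℕ.s≤s i<k)))
    (+-identityˡ _)

  sign-cong : ∀ j {x y} → x ≈ y → sign j x ≈ sign j y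
  sign-cong zero    x≈y = x≈y
  sign-cong (suc j) x≈y = -‿cong (sign-cong j x≈y)

  sign-zero : ∀ j → sign j 0# ≈ 0#
  sign-zero zero    = refl
  sign-zero (suc j) = trans (-‿cong (sign-zero j)) -0#≈0#

  sign-+ : ∀ j x y → sign j (x + y) ≈ sign j x + sign j y
  sign-+ zero    x y = refl
  sign-+ (suc j) x y = trans (-‿cong (sign-+ j x y)) (sym (-‿+-comm _ _))

  sign-*ʳ : ∀ j x y → sign j (x * y) ≈ x * sign j y
  sign-*ʳ zero    x y = refl
  sign-*ʳ (suc j) x y = trans (-‿cong (sign-*ʳ j x y)) (-‿distribʳ-* x _)

  sign-*ˡ : ∀ j x y → sign j (x * y) ≈ sign j x * y
  sign-*ˡ zero    x y = refl
  sign-*ˡ (suc j) x y = trans (-‿cong (sign-*ˡ j x y)) (-‿distribˡ-* _ y)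

  sign-neg : ∀ j x → sign j (- x) ≈ - sign j x
  sign-neg zero    x = refl
  sign-neg (suc j) x = -‿cong (sign-neg j x)

  sign-involutive : ∀ j x → sign j (sign j x) ≈ x
  sign-involutive zero    x = refl
  sign-involutive (suc j) x = begin
    - sign j (- sign j x)  ≈⟨ -‿cong (sign-neg j (sign j x)) ⟩
    - - sign j (sign j x)  ≈⟨ -‿involutive _ ⟩
    sign j (sign j x)      ≈⟨ sign-involutive j x ⟩
    x                      ∎

  laplace : ∀ k → (Fin k → K) → (Fin k → K) → K
  laplace k x minor = ΣFin k (λ j → sign (toℕ j) (x j * minor j))

  laplace-cong : ∀ k {x x′ y y′ : Fin k → K} → (∀ j → x j ≈ x′ j) → (∀ j → y j ≈ y′ j) →
                 laplace k x y ≈ laplace k x′ y′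
  laplace-cong k x≈ y≈ = ΣFin-cong k λ j → sign-cong (toℕ j) (*-cong (x≈ j) (y≈ j))

  laplace-congʳ : ∀ k (x : Fin k → K) {y y′ : Fin k → K} → (∀ j → y j ≈ y′ j) →
                  laplace k x y ≈ laplace k x y′
  laplace-congʳ k x = laplace-cong k {x} {x} (λ _ → refl)

  laplace-+ˡ : ∀ k x x′ y → laplace k (λ j → x j + x′ j) y ≈ laplace k x y + laplace k x′ y
  laplace-+ˡ k x x′ y = trans
    (ΣFin-cong k λ j → trans (sign-cong (toℕ j) (distribʳ (y j) _ _)) (sign-+ (toℕ j) _ _))
    (ΣFin-+ k _ _)

  laplace-+ʳ : ∀ k x y y′ → laplace k x (λ j → y j + y′ j) ≈ laplace k x y + laplace k x y′
  laplace-+ʳ k x y y′ = trans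
    (ΣFin-cong k λ j → trans (sign-cong (toℕ j) (distribˡ (x j) _ _)) (sign-+ (toℕ j) _ _))
    (ΣFin-+ k _ _)

  laplace-*ˡ : ∀ k z x y → laplace k (λ j → z * x j) y ≈ z * laplace k x y
  laplace-*ˡ k z x y = trans
    (ΣFin-cong k λ j → trans (sign-cong (toℕ j) (*-assoc z _ _)) (sign-*ʳ (toℕ j) z _))
    (ΣFin-*ˡ k z _)

  laplace-*ʳ : ∀ k z x y → laplace k x (λ j → z * y j) ≈ z * laplace k x y
  laplace-*ʳ k z x y = trans
    (ΣFin-cong k λ j → trans
      (sign-cong (toℕ j) (solve 3 (λ z x y → x :* (z :* y) := z :* (x :* y)) refl z (x j) (y j)))
      (sign-*ʳ (toℕ j) z _))
    (ΣFin-*ˡ k z _)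

  _≋_ : ∀ {k} → Vect k → Vect k → Set ℓ
  u ≋ u′ = ∀ r → u r ≈ u′ r

  det-cong : ∀ k {M N : Mat k} → M ≡ₘ N → det k M ≈ det k N
  det-cong zero    M≈N = refl
  det-cong (suc k) M≈N = laplace-cong (suc k) (M≈N zero)
    λ j → det-cong k λ r s → M≈N (suc r) (punchIn j s)

  bracket-cong : ∀ k {u u′ : Fin k → Vect k} → (∀ j → u j ≋ u′ j) → bracket k u ≈ bracket k u′
  bracket-cong k u≈ = det-cong k λ r s → u≈ s r

  minors : ∀ {k} → (Fin (suc k) → Vect (suc k)) → Fin (suc k) → Fin k → Vect k
  minors u j s r = u (punchIn j s) (suc r)

  -- The selections of columns that keep column 0: what is left when both removed columns are
  -- nonzero.
  extend-suc : ∀ {n N} → (Fin n → Fin N) → Fin (suc n) → Fin (suc N)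
  extend-suc f zero    = zero
  extend-suc f (suc s) = suc (f s)

  -- The double Laplace expansion along two equal rows x: the terms removing the
  -- columns {i, j} in the two possible orders cancel.
  laplace-repeated : ∀ n (x : Fin (suc (suc n)) → K) (H : (Fin n → Fin (suc (suc n))) → K) →
    (∀ f g → (∀ s → f s ≡ g s) → H f ≈ H g) →
    laplace (suc (suc n)) x (λ j → laplace (suc n) (x ∘ punchIn j)
      (λ l → H (λ s → punchIn j (punchIn l s)))) ≈ 0#
  laplace-repeated n x H H-cong = begin
    -- Column 0 is removed either in the outer expansion (`x zero * Y`) or in the inner one (the
    -- summands `x zero * h j`), with opposite signs. `T` collects the pairs avoiding column 0;
    -- there the minors have the form `H ∘ extend-suc` and the lemma applies with one column fewer.
    x zero * Y + ΣFin (suc n) (λ j → - sign (toℕ j) (x (suc j) * (x zero * h j + T j)))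
      ≈⟨ +-congˡ (ΣFin-neg (suc n) (λ j → sign (toℕ j) (x (suc j) * (x zero * h j + T j)))) ⟩
    x zero * Y - laplace (suc n) (x ∘ suc) (λ j → x zero * h j + T j)
      ≈⟨ +-congˡ (-‿cong (laplace-+ʳ (suc n) (x ∘ suc) (λ j → x zero * h j) T)) ⟩
    x zero * Y - (laplace (suc n) (x ∘ suc) (λ j → x zero * h j) + laplace (suc n) (x ∘ suc) T)
      ≈⟨ +-congˡ (-‿cong (+-cong (laplace-*ʳ (suc n) (x zero) (x ∘ suc) h) (rest n x H H-cong))) ⟩
    x zero * Y - (x zero * Y + 0#)
      ≈⟨ +-congˡ (-‿cong (+-identityʳ _)) ⟩
    x zero * Y - x zero * Y
      ≈⟨ -‿inverseʳ _ ⟩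
    0# ∎
    where
    h : Fin (suc n) → K
    h j = H (λ s → suc (punchIn j s))
    Y = laplace (suc n) (x ∘ suc) h
    tail : ∀ n → (Fin (suc (suc n)) → K) → ((Fin n → Fin (suc (suc n))) → K) → Fin (suc n) → K
    tail n x H j = ΣFin n (λ l → - sign (toℕ l) (x (suc (punchIn j l)) *
                     H (λ s → punchIn (suc j) (punchIn (suc l) s))))
    T = tail n x H
    rest : ∀ n x H → (∀ f g → (∀ s → f s ≡ g s) → H f ≈ H g) →
           laplace (suc n) (x ∘ suc) (tail n x H) ≈ 0#
    rest zero    x H H-cong = trans (+-identityʳ _) (zeroʳ _)
    rest (suc n) x H H-cong = begin
      laplace (suc (suc n)) (x ∘ suc) (tail (suc n) x H)
        ≈⟨ ΣFin-cong (suc (suc n)) (λ j → trans (sign-cong (toℕ j) (trans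
             (*-congˡ {x (suc j)} (ΣFin-neg (suc n) (t j))) (sym (-‿distribʳ-* (x (suc j)) _))))
             (sign-neg (toℕ j) _)) ⟩
      ΣFin (suc (suc n)) (λ j → - sign (toℕ j) (x (suc j) * ΣFin (suc n) (t j)))
        ≈⟨ ΣFin-neg (suc (suc n)) (λ j → sign (toℕ j) (x (suc j) * ΣFin (suc n) (t j))) ⟩
      - laplace (suc (suc n)) (x ∘ suc) (λ j → ΣFin (suc n) (t j))
        ≈⟨ -‿cong (laplace-congʳ (suc (suc n)) (x ∘ suc) λ j →
             laplace-congʳ (suc n) (x ∘ suc ∘ punchIn j) λ l →
               H-cong (λ s → punchIn (suc j) (punchIn (suc l) s))
                      (extend-suc (λ s → punchIn j (punchIn l s)))
                      λ { zero → ≡.refl ; (suc s) → ≡.refl }) ⟩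
      - laplace (suc (suc n)) (x ∘ suc) (λ j → laplace (suc n) (x ∘ suc ∘ punchIn j)
          (λ l → H (extend-suc (λ s → punchIn j (punchIn l s)))))
        ≈⟨ -‿cong (laplace-repeated n (x ∘ suc) (H ∘ extend-suc) λ f g f≡g →
             H-cong (extend-suc f) (extend-suc g) λ { zero → ≡.refl ; (suc s) → ≡.cong suc (f≡g s) }) ⟩
      - 0#
        ≈⟨ -0#≈0# ⟩
      0# ∎
      where
      t : Fin (suc (suc n)) → Fin (suc n) → K
      t j l = sign (toℕ l) (x (suc (punchIn j l)) * H (λ s → punchIn (suc j) (punchIn (suc l) s)))

  -- Expresses that `f` has determinant `δ` through its effect on brackets, so that factors multiply
  -- along a composition at once.
  ScalesBy : ∀ {k} → K → (Vect k → Vect k) → Set (c ⊔ ℓ)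
  ScalesBy {k} δ f = ∀ u → bracket k (f ∘ u) ≈ δ * bracket k u

  shearDown : ∀ {k} → K → Vect k → Vect k
  shearDown z u zero          = u zero
  shearDown z u (suc zero)    = u (suc zero) + z * u zero
  shearDown z u (suc (suc r)) = u (suc (suc r))

  shearUp : ∀ {k} → K → Vect (suc (suc k)) → Vect (suc (suc k))
  shearUp z u zero    = u zero + z * u (suc zero)
  shearUp z u (suc r) = u (suc r)

  scaleFirst : ∀ {k} → K → Vect k → Vect k
  scaleFirst z u zero    = z * u zero
  scaleFirst z u (suc r) = u (suc r)

  onTail : ∀ {k} → (Vect k → Vect k) → Vect (suc k) → Vect (suc k)
  onTail f u zero    = u zero
  onTail f u (suc r) = f (u ∘ suc) r

  -- By linearity in the second row, the added multiple of the first row contributes a determinant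
  -- with two equal rows.
  shearDown-scales : ∀ {k} z → ScalesBy {k} 1# (shearDown z)
  shearDown-scales {zero}        z u = sym (*-identityˡ 1#)
  shearDown-scales {suc zero}    z u = sym (*-identityˡ _)
  shearDown-scales {suc (suc n)} z u = begin
    laplace (suc (suc n)) x (λ j → laplace (suc n) (λ l → y (punchIn j l) + z * x (punchIn j l)) (h j))
      ≈⟨ laplace-congʳ (suc (suc n)) x (λ j → trans (laplace-+ˡ (suc n) (y ∘ punchIn j) (λ l → z * x (punchIn j l)) (h j))
           (+-congˡ (laplace-*ˡ (suc n) z (x ∘ punchIn j) (h j)))) ⟩
    laplace (suc (suc n)) x (λ j → Y j + z * X j)
      ≈⟨ trans (laplace-+ʳ (suc (suc n)) x Y (λ j → z * X j)) (+-congˡ (laplace-*ʳ (suc (suc n)) z x X)) ⟩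
    laplace (suc (suc n)) x Y + z * laplace (suc (suc n)) x X
      ≈⟨ +-congˡ (*-congˡ (laplace-repeated n x H λ f g f≡g → det-cong n λ r s →
           reflexive (≡.cong (λ j → u j (suc (suc r))) (f≡g s)))) ⟩
    laplace (suc (suc n)) x Y + z * 0#
      ≈⟨ solve 2 (λ a z → a :+ z :* con 0 := con 1 :* a) refl _ z ⟩
    1# * laplace (suc (suc n)) x Y ∎
    where
    x y : Fin (suc (suc n)) → K
    x j = u j zero
    y j = u j (suc zero)
    H : (Fin n → Fin (suc (suc n))) → K
    H f = det n (λ r s → u (f s) (suc (suc r)))
    h : Fin (suc (suc n)) → Fin (suc n) → K
    h j l = H (λ s → punchIn j (punchIn l s))
    X Y : Fin (suc (suc n)) → K
    X j = laplace (suc n) (x ∘ punchIn j) (h j)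
    Y j = laplace (suc n) (y ∘ punchIn j) (h j)

  shearUp-scales : ∀ {k} z → ScalesBy {suc (suc k)} 1# (shearUp z)
  shearUp-scales {n} z u = begin
    laplace (suc (suc n)) (λ j → x j + z * y j) Y
      ≈⟨ trans (laplace-+ˡ (suc (suc n)) x (λ j → z * y j) Y) (+-congˡ (laplace-*ˡ (suc (suc n)) z y Y)) ⟩
    laplace (suc (suc n)) x Y + z * laplace (suc (suc n)) y Y
      ≈⟨ +-congˡ (*-congˡ (laplace-repeated n y H λ f g f≡g → det-cong n λ r s →
           reflexive (≡.cong (λ j → u j (suc (suc r))) (f≡g s)))) ⟩
    laplace (suc (suc n)) x Y + z * 0#
      ≈⟨ solve 2 (λ a z → a :+ z :* con 0 := con 1 :* a) refl _ z ⟩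
    1# * laplace (suc (suc n)) x Y ∎
    where
    x y : Fin (suc (suc n)) → K
    x j = u j zero
    y j = u j (suc zero)
    H : (Fin n → Fin (suc (suc n))) → K
    H f = det n (λ r s → u (f s) (suc (suc r)))
    Y : Fin (suc (suc n)) → K
    Y j = laplace (suc n) (y ∘ punchIn j) (λ l → H (λ s → punchIn j (punchIn l s)))

  scaleFirst-scales : ∀ {k} z → ScalesBy {suc k} z (scaleFirst z)
  scaleFirst-scales {k} z u =
    laplace-*ˡ (suc k) z (λ j → u j zero) (λ j → bracket k (minors u j))

  -- Linear automorphisms and bidiagonal matrices

  -- Frames are words in elementary maps, so each carries its inverse as a function. Matrices are
  -- extracted only for `A` and `Ainv` of the final point. Linearity of `from` follows from that of
  -- `to`.
  record Aut (k : ℕ) : Set (c ⊔ ℓ) where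
    field
      to from   : Vect k → Vect k
      to-cong   : ∀ {u v} → u ≋ v → to u ≋ to v
      from-cong : ∀ {u v} → u ≋ v → from u ≋ from v
      to-+      : ∀ u v → to (λ r → u r + v r) ≋ (λ r → to u r + to v r)
      to-*      : ∀ z u → to (λ r → z * u r) ≋ (λ r → z * to u r)
      to-from   : ∀ u → to (from u) ≋ u
      from-to   : ∀ u → from (to u) ≋ u
  open Aut

  idₐ : ∀ {k} → Aut k
  idₐ = record
    { to = λ u → u ; from = λ u → u ; to-cong = λ p → p ; from-cong = λ p → p
    ; to-+ = λ _ _ _ → refl ; to-* = λ _ _ _ → refl
    ; to-from = λ _ _ → refl ; from-to = λ _ _ → refl }

  infixr 9 _∘ₐ_
  _∘ₐ_ : ∀ {k} → Aut k → Aut k → Aut k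
  f ∘ₐ g = record
    { to        = to f ∘ to g
    ; from      = from g ∘ from f
    ; to-cong   = λ p → to-cong f (to-cong g p)
    ; from-cong = λ p → from-cong g (from-cong f p)
    ; to-+      = λ u v r → trans (to-cong f (to-+ g u v) r) (to-+ f _ _ r)
    ; to-*      = λ z u r → trans (to-cong f (to-* g z u) r) (to-* f z _ r)
    ; to-from   = λ u r → trans (to-cong f (to-from g _) r) (to-from f u r)
    ; from-to   = λ u r → trans (from-cong g (from-to f _) r) (from-to g u r)
    }

  _⁻¹ₐ : ∀ {k} → Aut k → Aut k
  f ⁻¹ₐ = record
    { to        = from f
    ; from      = to f
    ; to-cong   = from-cong f
    ; from-cong = to-cong f
    ; to-+      = λ u v r → trans
        (from-cong f (λ s → sym (trans (to-+ f _ _ s) (+-cong (to-from f u s) (to-from f v s)))) r)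
        (from-to f _ r)
    ; to-*      = λ z u r → trans
        (from-cong f (λ s → sym (trans (to-* f z _ s) (*-congˡ (to-from f u s)))) r)
        (from-to f _ r)
    ; to-from   = from-to f
    ; from-to   = to-from f
    }

  ScalesBy-∘ : ∀ {k δ ε} (f g : Aut k) → ScalesBy δ (to f) → ScalesBy ε (to g) →
               ScalesBy (δ * ε) (to (f ∘ₐ g))
  ScalesBy-∘ f g f-scales g-scales u = trans (f-scales (to g ∘ u))
    (trans (*-congˡ (g-scales u)) (sym (*-assoc _ _ _)))

  ScalesBy-≈ : ∀ {k δ ε} (f : Aut k) → δ ≈ ε → ScalesBy δ (to f) → ScalesBy ε (to f)
  ScalesBy-≈ f δ≈ε f-scales u = trans (f-scales u) (*-congʳ δ≈ε)

  onTail-scales : ∀ {k δ} (f : Aut k) → ScalesBy δ (to f) → ScalesBy δ (onTail (to f))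
  onTail-scales {k} {δ} f f-scales u = trans
    (laplace-congʳ (suc k) (λ j → u j zero) (λ j → f-scales (minors u j)))
    (laplace-*ʳ (suc k) δ (λ j → u j zero) (λ j → bracket k (minors u j)))

  record Unit : Set (c ⊔ ℓ) where
    no-eta-equality
    field
      val inv : K
      val*inv : val * inv ≈ 1#
  open Unit

  infixl 7 _⊛_ _⊘_
  _⊛_ _⊘_ : Unit → Unit → Unit
  val (s ⊛ t) = val s * val t
  inv (s ⊛ t) = inv s * inv t
  val*inv (s ⊛ t) = begin
    (val s * val t) * (inv s * inv t)  ≈⟨ solve 4 (λ a b x y → (a :* b) :* (x :* y) := (a :* x) :* (b :* y)) refl _ _ _ _ ⟩
    (val s * inv s) * (val t * inv t)  ≈⟨ *-cong (val*inv s) (val*inv t) ⟩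
    1# * 1#                            ≈⟨ *-identityˡ 1# ⟩
    1#                                 ∎
  s ⊘ t = s ⊛ t⁻¹
    where
    t⁻¹ : Unit
    val t⁻¹     = inv t
    inv t⁻¹     = val t
    val*inv t⁻¹ = trans (*-comm _ _) (val*inv t)

  shearDownₐ : ∀ {k} → K → Aut k
  shearDownₐ z = record
    { to        = shearDown z
    ; from      = shearDown (- z)
    ; to-cong   = shearDown-cong z
    ; from-cong = shearDown-cong (- z)
    ; to-+      = λ { u v zero → refl
                    ; u v (suc zero) → solve 5 (λ a b z x y → (a :+ b) :+ z :* (x :+ y) :=
                        (a :+ z :* x) :+ (b :+ z :* y)) refl _ _ z _ _
                    ; u v (suc (suc r)) → refl }
    ; to-*      = λ { y u zero → refl
                    ; y u (suc zero) → solve 4 (λ a b z x → x :* b :+ z :* (x :* a) :=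
                        x :* (b :+ z :* a)) refl (u zero) (u (suc zero)) z y
                    ; y u (suc (suc r)) → refl }
    ; to-from   = λ { u zero → refl
                    ; u (suc zero) → trans (+-assoc _ _ _) (trans (+-congˡ (trans
                        (sym (distribʳ (u zero) _ _)) (trans (*-congʳ (-‿inverseˡ z)) (zeroˡ _))))
                        (+-identityʳ _))
                    ; u (suc (suc r)) → refl }
    ; from-to   = λ { u zero → refl
                    ; u (suc zero) → trans (+-assoc _ _ _) (trans (+-congˡ (trans
                        (sym (distribʳ (u zero) _ _)) (trans (*-congʳ (-‿inverseʳ z)) (zeroˡ _))))
                        (+-identityʳ _))
                    ; u (suc (suc r)) → refl }
    }
    where
    shearDown-cong : ∀ {k} z {u v : Vect k} → u ≋ v → shearDown z u ≋ shearDown z v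
    shearDown-cong z p zero          = p zero
    shearDown-cong z p (suc zero)    = +-cong (p (suc zero)) (*-congˡ (p zero))
    shearDown-cong z p (suc (suc r)) = p (suc (suc r))

  shearUpₐ : ∀ {k} → K → Aut (suc (suc k))
  shearUpₐ z = record
    { to        = shearUp z
    ; from      = shearUp (- z)
    ; to-cong   = shearUp-cong z
    ; from-cong = shearUp-cong (- z)
    ; to-+      = λ { u v zero → solve 5 (λ a b z x y → (a :+ b) :+ z :* (x :+ y) :=
                        (a :+ z :* x) :+ (b :+ z :* y)) refl _ _ z _ _
                    ; u v (suc r) → refl }
    ; to-*      = λ { y u zero → solve 4 (λ a b z x → x :* b :+ z :* (x :* a) :=
                        x :* (b :+ z :* a)) refl (u (suc zero)) (u zero) z y
                    ; y u (suc r) → refl }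
    ; to-from   = λ { u zero → trans (+-assoc _ _ _) (trans (+-congˡ (trans
                        (sym (distribʳ (u (suc zero)) _ _)) (trans (*-congʳ (-‿inverseˡ z)) (zeroˡ _))))
                        (+-identityʳ _))
                    ; u (suc r) → refl }
    ; from-to   = λ { u zero → trans (+-assoc _ _ _) (trans (+-congˡ (trans
                        (sym (distribʳ (u (suc zero)) _ _)) (trans (*-congʳ (-‿inverseʳ z)) (zeroˡ _))))
                        (+-identityʳ _))
                    ; u (suc r) → refl }
    }
    where
    shearUp-cong : ∀ {k} z {u v : Vect (suc (suc k))} → u ≋ v → shearUp z u ≋ shearUp z v
    shearUp-cong z p zero    = +-cong (p zero) (*-congˡ (p (suc zero)))
    shearUp-cong z p (suc r) = p (suc r)

  scaleFirstₐ : ∀ {k} → Unit → Aut k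
  scaleFirstₐ x = record
    { to        = scaleFirst a
    ; from      = scaleFirst a⁻
    ; to-cong   = scaleFirst-cong a
    ; from-cong = scaleFirst-cong a⁻
    ; to-+      = λ { u v zero → distribˡ a _ _ ; u v (suc r) → refl }
    ; to-*      = λ { z u zero → solve 3 (λ a z x → a :* (z :* x) := z :* (a :* x)) refl a z _
                    ; z u (suc r) → refl }
    ; to-from   = λ { u zero → trans (sym (*-assoc a a⁻ _)) (trans (*-congʳ a*a⁻) (*-identityˡ _))
                    ; u (suc r) → refl }
    ; from-to   = λ { u zero → trans (sym (*-assoc a⁻ a _))
                        (trans (*-congʳ (trans (*-comm a⁻ a) a*a⁻)) (*-identityˡ _))
                    ; u (suc r) → refl }
    }
    where
    a = val x
    a⁻ = inv x
    a*a⁻ = val*inv x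
    scaleFirst-cong : ∀ {k} z {u v : Vect k} → u ≋ v → scaleFirst z u ≋ scaleFirst z v
    scaleFirst-cong z p zero    = *-congˡ (p zero)
    scaleFirst-cong z p (suc r) = p (suc r)

  onTailₐ : ∀ {k} → Aut k → Aut (suc k)
  onTailₐ f = record
    { to        = onTail (to f)
    ; from      = onTail (from f)
    ; to-cong   = λ { p zero → p zero ; p (suc r) → to-cong f (p ∘ suc) r }
    ; from-cong = λ { p zero → p zero ; p (suc r) → from-cong f (p ∘ suc) r }
    ; to-+      = λ { u v zero → refl ; u v (suc r) → to-+ f _ _ r }
    ; to-*      = λ { z u zero → refl ; z u (suc r) → to-* f z _ r }
    ; to-from   = λ { u zero → refl ; u (suc r) → to-from f _ r }
    ; from-to   = λ { u zero → refl ; u (suc r) → from-to f _ r }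
    }

  -- x and y are indexed by the distance of a row from the
  -- last row (for y, from the last but one), which is stable under onTail.
  lowerₐ : ∀ k → (ℕ → Unit) → Aut k
  lowerₐ zero    x = idₐ
  lowerₐ (suc k) x = scaleFirstₐ (x k) ∘ₐ shearDownₐ 1# ∘ₐ onTailₐ (lowerₐ k x)

  upperₐ : ∀ k → (ℕ → K) → Aut k
  upperₐ zero          y = idₐ
  upperₐ (suc zero)    y = idₐ
  upperₐ (suc (suc k)) y = onTailₐ (upperₐ (suc k) y) ∘ₐ shearUpₐ (y k)

  prod : (ℕ → K) → ℕ → K
  prod x zero    = 1#
  prod x (suc k) = x k * prod x k

  lower-scales : ∀ k x → ScalesBy (prod (val ∘ x) k) (to (lowerₐ k x))
  lower-scales zero    x u = sym (*-identityˡ _)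
  lower-scales (suc k) x =
    ScalesBy-∘ (scaleFirstₐ (x k)) (shearDownₐ 1# ∘ₐ f) (scaleFirst-scales (val (x k)))
      (ScalesBy-≈ (shearDownₐ 1# ∘ₐ f) (*-identityˡ _)
        (ScalesBy-∘ (shearDownₐ 1#) f (shearDown-scales 1#)
          (onTail-scales (lowerₐ k x) (lower-scales k x))))
    where f = onTailₐ (lowerₐ k x)

  upper-scales : ∀ k y → ScalesBy 1# (to (upperₐ k y))
  upper-scales zero          y u = sym (*-identityˡ _)
  upper-scales (suc zero)    y u = sym (*-identityˡ _)
  upper-scales (suc (suc k)) y = ScalesBy-≈ (upperₐ (suc (suc k)) y) (*-identityˡ _)
    (ScalesBy-∘ (onTailₐ (upperₐ (suc k) y)) (shearUpₐ (y k))
      (onTail-scales (upperₐ (suc k) y) (upper-scales (suc k) y)) (shearUp-scales (y k)))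

  -- Leading entries and block-triangular brackets

  -- The shape of the coordinates of v_{i+a} in a frame adapted to F_i, with the leading coefficient
  -- normalised to 1.
  Up : ∀ {k} → ℕ → Vect k → Set ℓ
  Up a u = ∀ r → (toℕ r ≡ a → u r ≈ 1#) × (a ℕ.< toℕ r → u r ≈ 0#)

  -- b is the distance of the leading entry κ from the last row.
  Low : ∀ {k} → ℕ → K → Vect k → Set ℓ
  Low {k} b κ u = ∀ r → (toℕ r ℕ.+ suc b ≡ k → u r ≈ κ) × (toℕ r ℕ.+ suc b ℕ.< k → u r ≈ 0#)

  to-zero : ∀ {k} (f : Aut k) {u} → (∀ r → u r ≈ 0#) → ∀ r → to f u r ≈ 0#
  to-zero f {u} u≈0 r = begin
    to f u r                 ≈⟨ to-cong f (λ s → trans (u≈0 s) (sym (zeroˡ (u s)))) r ⟩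
    to f (λ s → 0# * u s) r  ≈⟨ to-* f 0# u r ⟩
    0# * to f u r            ≈⟨ zeroˡ _ ⟩
    0#                       ∎

  Up-tail : ∀ {k a} {u : Vect (suc k)} → Up (suc a) u → Up a (u ∘ suc)
  Up-tail up r = (λ r≡a → proj₁ (up (suc r)) (≡.cong suc r≡a)) , (λ a<r → proj₂ (up (suc r)) (ℕ.s≤s a<r))

  Up-tail-zero : ∀ {k} {u : Vect (suc k)} → Up 0 u → ∀ r → u (suc r) ≈ 0#
  Up-tail-zero up r = proj₂ (up (suc r)) (ℕ.s≤s ℕ.z≤n)

  Low-tail : ∀ {k b κ} {u : Vect (suc k)} → Low b κ u → Low b κ (u ∘ suc)
  Low-tail low r = (λ e → proj₁ (low (suc r)) (≡.cong suc e)) , (λ lt → proj₂ (low (suc r)) (ℕ.s≤s lt))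

  -- An upper triangular matrix with unit diagonal has an inverse of the same kind.
  upper-from-Up : ∀ k y a {u} → Up a u → Up a (from (upperₐ k y) u)
  upper-from-Up zero          y a up = up
  upper-from-Up (suc zero)    y a up = up
  upper-from-Up (suc (suc k)) y zero {u} up zero =
    (λ _ → trans (+-cong (proj₁ (up zero) ≡.refl)
                         (trans (*-congˡ (to-zero (upperₐ (suc k) y ⁻¹ₐ) (Up-tail-zero up) zero)) (zeroʳ _)))
                 (+-identityʳ 1#))
    , λ ()
  upper-from-Up (suc (suc k)) y zero up (suc r) =
    (λ ()) , λ _ → to-zero (upperₐ (suc k) y ⁻¹ₐ) (Up-tail-zero up) r
  upper-from-Up (suc (suc k)) y (suc a) up zero = (λ ()) , λ ()
  upper-from-Up (suc (suc k)) y (suc a) up (suc r) =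
    let p , q = upper-from-Up (suc k) y a (Up-tail up) r
    in (λ e → p (ℕ.suc-injective e)) , λ { (ℕ.s≤s lt) → q lt }

  -- Below the leading entry only the subdiagonal contributes, and its entries 1 pass the leading 1
  -- on to the next row.
  lower-to-Up : ∀ k x a {u} → Up a u → Up (suc a) (to (lowerₐ k x) u)
  lower-to-Up (suc k) x a up zero = (λ ()) , λ ()
  lower-to-Up (suc k) x zero up (suc zero) =
    (λ _ → trans (+-cong (to-zero (lowerₐ k x) (Up-tail-zero up) zero) (*-identityˡ _))
                 (trans (+-identityˡ _) (proj₁ (up zero) ≡.refl)))
    , λ { (ℕ.s≤s ()) }
  lower-to-Up (suc k) x (suc a) up (suc zero) = (λ ()) , λ { (ℕ.s≤s ()) }
  lower-to-Up (suc k) x zero up (suc (suc r)) =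
    (λ ()) , λ _ → to-zero (lowerₐ k x) (Up-tail-zero up) (suc r)
  lower-to-Up (suc k) x (suc a) up (suc (suc r)) =
    let p , q = lower-to-Up k x a (Up-tail up) (suc r)
    in (λ e → p (ℕ.suc-injective e)) , λ { (ℕ.s≤s lt) → q lt }

  lower-from-Low : ∀ k x b {κ u} → Low b κ u → Low b (inv (x b) * κ) (from (lowerₐ k x) u)
  lower-from-Low (suc k) x b low zero =
    (λ { ≡.refl → *-congˡ (proj₁ (low zero) ≡.refl) })
    , λ lt → trans (*-congˡ (proj₂ (low zero) lt)) (zeroʳ _)
  lower-from-Low (suc k) x b {κ} {u} low (suc r) =
    (λ e → proj₁ (below (ℕ.m+n≤o⇒n≤o (toℕ r) (ℕ.≤-reflexive (ℕ.suc-injective e)))) (ℕ.suc-injective e))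
    , λ { (ℕ.s≤s lt) → proj₂ (below (ℕ.m+n≤o⇒n≤o (toℕ r) (ℕ.<⇒≤ lt))) lt }
    where
    u′ : Vect k
    u′ = shearDown (- 1#) (scaleFirst (inv (x k)) u) ∘ suc
    -- When the leading entry lies below row 0, the entry in row 0 vanishes, so undoing the shear
    -- leaves the tail unchanged.
    module _ (b<k : suc b ≤ k) where
      u′≋tail : u′ ≋ (u ∘ suc)
      u′≋tail zero    = trans (+-congˡ (trans (*-congˡ (trans
        (*-congˡ (proj₂ (low zero) (ℕ.s≤s b<k))) (zeroʳ _))) (zeroʳ _))) (+-identityʳ _)
      u′≋tail (suc r) = refl
      low′ : Low b κ u′
      low′ s = let p , q = Low-tail low s
               in (λ e → trans (u′≋tail s) (p e)) , λ lt → trans (u′≋tail s) (q lt)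
      below = lower-from-Low k x b low′ r

  -- The row just above the leading entry is itself 0 there and receives only the superdiagonal
  -- multiple of `κ`.
  upper-to-Low : ∀ k y b {κ u} → Low b κ u → Low (suc b) (y b * κ) (to (upperₐ k y) u)
  upper-to-Low (suc zero)    y b low zero = (λ ()) , λ { (ℕ.s≤s ()) }
  upper-to-Low (suc (suc k)) y b low zero =
    (λ { ≡.refl → trans (+-cong (proj₂ (low zero) ℕ.≤-refl) (*-congˡ (proj₁ (low (suc zero)) ≡.refl)))
                        (+-identityˡ _) })
    , λ lt → trans (+-cong (proj₂ (low zero) (ℕ.<⇒≤ lt))
                           (trans (*-congˡ (proj₂ (low (suc zero)) lt)) (zeroʳ _)))
                   (+-identityˡ _)
  upper-to-Low (suc (suc k)) y b low (suc r) =
    let p , q = upper-to-Low (suc k) y b (Low-tail low) r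
    in (λ e → p (ℕ.suc-injective e)) , λ { (ℕ.s≤s lt) → q lt }

  -- `det` expands along the first row: the term of column 0 has a zero factor, and every other
  -- minor still has a zero first column.
  bracket-zeroColumn : ∀ k (u : Fin (suc k) → Vect (suc k)) → (∀ r → u zero r ≈ 0#) → bracket (suc k) u ≈ 0#
  bracket-zeroColumn k u u₀≈0 = ΣFin-zero (suc k)
    λ j → trans (sign-cong (toℕ j) (term k u u₀≈0 j)) (sign-zero (toℕ j))
    where
    term : ∀ k (u : Fin (suc k) → Vect (suc k)) → (∀ r → u zero r ≈ 0#) →
           ∀ j → u j zero * bracket k (minors u j) ≈ 0#
    term k       u u₀≈0 zero    = trans (*-congʳ (u₀≈0 zero)) (zeroˡ _)
    term (suc k) u u₀≈0 (suc j) = trans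
      (*-congˡ (bracket-zeroColumn k (minors u (suc j)) (u₀≈0 ∘ suc))) (zeroʳ _)

  bracket-firstColumn : ∀ k (u : Fin (suc k) → Vect (suc k)) → Up 0 (u zero) →
                        bracket (suc k) u ≈ bracket k (minors u zero)
  bracket-firstColumn k u up = trans
    (+-cong (trans (*-congʳ (proj₁ (up zero) ≡.refl)) (*-identityˡ _))
            (ΣFin-zero k λ j → trans (-‿cong (trans (sign-cong (toℕ j) (term k u (Up-tail-zero up) j))
                                                     (sign-zero (toℕ j)))) -0#≈0#))
    (+-identityʳ _)
    where
    term : ∀ k (u : Fin (suc k) → Vect (suc k)) → (∀ r → u zero (suc r) ≈ 0#) →
           ∀ j → u (suc j) zero * bracket k (minors u (suc j)) ≈ 0#
    term (suc k) u u₀≈0 j = trans (*-congˡ (bracket-zeroColumn k (minors u (suc j)) u₀≈0)) (zeroʳ _)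

  toℕ-punchIn-last : ∀ k (s : Fin k) → toℕ (punchIn (Fin.fromℕ k) s) ≡ toℕ s
  toℕ-punchIn-last (suc k) zero    = ≡.refl
  toℕ-punchIn-last (suc k) (suc s) = ≡.cong suc (toℕ-punchIn-last k s)

  -- Only the last column meets the first row. Its cofactor sign is cancelled by the `sign b` built
  -- into the leading entries, which thus absorbs the sign of the reversing permutation.
  bracket-antitriangular : ∀ k κ (u : Fin k → Vect k) →
    (∀ j b → toℕ j ≡ b → Low b (sign b (κ b)) (u j)) → bracket k u ≈ prod κ k
  bracket-antitriangular zero    κ u low = refl
  bracket-antitriangular (suc k) κ u low = begin
    bracket (suc k) u
      ≈⟨ ΣFin-last k _ (λ j j<k → trans (sign-cong (toℕ j) (trans
           (*-congʳ {bracket k (minors u j)} (proj₂ (low j (toℕ j) ≡.refl zero) (ℕ.s≤s j<k)))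
           (zeroˡ _))) (sign-zero (toℕ j))) ⟩
    sign (toℕ last) (u last zero * bracket k (minors u last))
      ≈⟨ reflexive (≡.cong (λ b → sign b (u last zero * bracket k (minors u last))) (toℕ-fromℕ k)) ⟩
    sign k (u last zero * bracket k (minors u last))
      ≈⟨ sign-cong k (*-cong (proj₁ (low last k (toℕ-fromℕ k) zero) ≡.refl)
           (bracket-antitriangular k κ (minors u last) λ j b j≡b →
             Low-tail (low (punchIn last j) b (≡.trans (toℕ-punchIn-last k j) j≡b)))) ⟩
    sign k (sign k (κ k) * prod κ k)
      ≈⟨ sign-*ˡ k _ _ ⟩
    sign k (sign k (κ k)) * prod κ k
      ≈⟨ *-congʳ (sign-involutive k (κ k)) ⟩
    κ k * prod κ k ∎
    where last = Fin.fromℕ k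

  -- Each `Up` column in turn becomes a first column with the single entry 1 and is expanded away
  -- with its row. `Low` counts rows from the bottom, so it survives until only the antitriangular
  -- block is left.
  bracket-block : ∀ k α κ (u : Fin k → Vect k) → α ≤ k →
    (∀ j → toℕ j ℕ.< α → Up (toℕ j) (u j)) →
    (∀ j b → toℕ j ≡ α ℕ.+ b → Low b (sign b (κ b)) (u j)) →
    bracket k u ≈ prod κ (k ℕ.∸ α)
  bracket-block k       zero    κ u α≤k         up low = bracket-antitriangular k κ u low
  bracket-block (suc k) (suc α) κ u (ℕ.s≤s α≤k) up low = trans
    (bracket-firstColumn k u (up zero (ℕ.s≤s ℕ.z≤n)))
    (bracket-block k α κ (minors u zero) α≤k
      (λ j j<α → Up-tail (up (suc j) (ℕ.s≤s j<α)))
      (λ j b e → Low-tail (low (suc j) b (≡.cong suc e))))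

  -- Matrices of automorphisms and points built from quasi-periodic sequences

  basis : ∀ {k} → Fin k → Vect k
  basis s r = idMat _ r s

  basis-diagonal : ∀ {k} (r : Fin k) → basis r r ≈ 1#
  basis-diagonal zero    = refl
  basis-diagonal (suc r) = basis-diagonal r

  basis-off-diagonal : ∀ {k} (s r : Fin k) → toℕ s ≢ toℕ r → basis s r ≈ 0#
  basis-off-diagonal zero    zero    s≢r = ⊥-elim (s≢r ≡.refl)
  basis-off-diagonal zero    (suc r) s≢r = refl
  basis-off-diagonal (suc s) zero    s≢r = refl
  basis-off-diagonal (suc s) (suc r) s≢r = basis-off-diagonal s r (s≢r ∘ ≡.cong suc)

  basis-Up : ∀ {k} (s : Fin k) → Up (toℕ s) (basis s)
  basis-Up s r = (λ e → trans (reflexive (≡.cong (λ s → basis s r) (toℕ-injective (≡.sym e)))) (basis-diagonal r))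
               , (λ lt → basis-off-diagonal s r (ℕ.<⇒≢ lt))

  bracket-basis : ∀ k → bracket k basis ≈ 1#
  bracket-basis k = trans
    (bracket-block k k (λ _ → 1#) basis ℕ.≤-refl (λ s _ → basis-Up s)
      (λ s b e → ⊥-elim (ℕ.m+n≮m k b (≡.subst (ℕ._< k) e (toℕ<n s)))))
    (reflexive (≡.cong (prod (λ _ → 1#)) (ℕ.n∸n≡0 k)))

  -- Applied to each coordinate of an automorphism, this identifies it with multiplication by its
  -- matrix. The recursion restricts `φ` to vectors with first entry 0.
  functional-expand : ∀ k (φ : Vect k → K) → (∀ {u v} → u ≋ v → φ u ≈ φ v) →
    (∀ u v → φ (λ r → u r + v r) ≈ φ u + φ v) → (∀ z u → φ (λ r → z * u r) ≈ z * φ u) →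
    ∀ u → ΣFin k (λ s → φ (basis s) * u s) ≈ φ u
  functional-expand zero    φ φ-cong φ-+ φ-* u =
    trans (sym (zeroˡ (φ u))) (trans (sym (φ-* 0# u)) (φ-cong λ ()))
  functional-expand (suc k) φ φ-cong φ-+ φ-* u = begin
    φ (basis zero) * u zero + ΣFin k (λ s → φ (basis (suc s)) * u (suc s))
      ≈⟨ +-cong (trans (*-comm _ _) (sym (φ-* (u zero) (basis zero))))
           (ΣFin-cong k λ s → *-congʳ (φ-cong λ { zero → refl ; (suc r) → refl })) ⟩
    φ (λ r → u zero * basis zero r) + ΣFin k (λ s → φ (cons (basis s)) * u (suc s))
      ≈⟨ +-congˡ (functional-expand k (φ ∘ cons) (λ p → φ-cong λ { zero → refl ; (suc r) → p r })
           (λ u v → trans (φ-cong λ { zero → sym (+-identityˡ 0#) ; (suc r) → refl }) (φ-+ (cons u) (cons v)))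
           (λ z u → trans (φ-cong λ { zero → sym (zeroʳ z) ; (suc r) → refl }) (φ-* z (cons u)))
           (u ∘ suc)) ⟩
    φ (λ r → u zero * basis zero r) + φ (cons (u ∘ suc))
      ≈⟨ sym (φ-+ _ _) ⟩
    φ (λ r → u zero * basis zero r + cons (u ∘ suc) r)
      ≈⟨ φ-cong (λ { zero → trans (+-identityʳ _) (*-identityʳ _)
                   ; (suc r) → trans (+-congʳ (zeroʳ _)) (+-identityˡ _) }) ⟩
    φ u ∎
    where
    cons : Vect k → Vect (suc k)
    cons u zero    = 0#
    cons u (suc r) = u r

  matrix : ∀ {k} → Aut k → Mat k
  matrix f r s = to f (basis s) r

  matrix-apply : ∀ {k} (f : Aut k) u → (matrix f ·ᵥ u) ≋ to f u
  matrix-apply {k} f u r = functional-expand k (λ u → to f u r)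
    (λ p → to-cong f p r) (λ u v → to-+ f u v r) (λ z u → to-* f z u r) u

  matrix-det : ∀ {k} (f : Aut k) → ScalesBy 1# (to f) → det k (matrix f) ≈ 1#
  matrix-det {k} f f-scales = trans (f-scales basis) (trans (*-identityˡ _) (bracket-basis k))

  module _ (m n : ℕ) .{{_ : NonZero n}} where
    n-quasiperiodic : Aut (suc m) → (ℤ → Vect (suc m)) → Set ℓ
    n-quasiperiodic f X = ∀ i → X (i ℤ.+ + n) ≋ to f (X i)

    pointOf : (f : Aut (suc m)) → ScalesBy 1# (to f) → (V W : ℤ → Vect (suc m)) → Point m n
    pointOf f f-scales V W = record
      { v    = V ∘ idx
      ; w    = W ∘ idx
      ; A    = matrix f
      ; Ainv = matrix (f ⁻¹ₐ)
      ; detA = matrix-det f f-scales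
      ; invA = λ r s → trans (matrix-apply f (from f (basis s)) r) (to-from f (basis s) r)
      }

    -- `extend` applies a power of `A` or `Ainv` to the value at the residue index;
    -- quasi-periodicity turns each application into a shift of the index by `n` or by `- n`.
    extend-pointOf : ∀ f f-scales V W X → n-quasiperiodic f X → ∀ k →
                     extend (pointOf f f-scales V W) (X ∘ idx) k ≋ X k
    extend-pointOf f f-scales V W X X-qp k r = trans
      (powAct-shift ((k ℤ.- ℤ.1ℤ) /ℕ n) (idx (residue n k)) r)
      (reflexive (≡.cong (λ i → X i r) (≡.sym (residue-quotient n k))))
      where
      p = pointOf f f-scales V W
      ·ᵥ-cong : ∀ (M : Mat (suc m)) {u v} → u ≋ v → (M ·ᵥ u) ≋ (M ·ᵥ v)
      ·ᵥ-cong M u≋v r = ΣFin-cong (suc m) λ s → *-congˡ {M r s} (u≋v s)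
      forward : ∀ q j → iter (matrix f) q (X j) ≋ X (j ℤ.+ + q ℤ.* + n)
      forward zero    j r = reflexive (≡.cong (λ i → X i r) (≡.sym (ℤ.+-identityʳ j)))
      forward (suc q) j r = begin
        (matrix f ·ᵥ iter (matrix f) q (X j)) r ≈⟨ ·ᵥ-cong (matrix f) (forward q j) r ⟩
        (matrix f ·ᵥ X (j ℤ.+ + q ℤ.* + n)) r   ≈⟨ matrix-apply f _ r ⟩
        to f (X (j ℤ.+ + q ℤ.* + n)) r          ≈⟨ sym (X-qp _ r) ⟩
        X (j ℤ.+ + q ℤ.* + n ℤ.+ + n) r
          ≈⟨ reflexive (≡.cong (λ i → X i r) (ℤS.solve 3 (λ j q n →
               j ℤS.:+ q ℤS.:* n ℤS.:+ n ℤS.:= j ℤS.:+ (ℤS.con ℤ.1ℤ ℤS.:+ q) ℤS.:* n) ≡.refl j (+ q) (+ n))) ⟩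
        X (j ℤ.+ + suc q ℤ.* + n) r             ∎
      back : ∀ j → (matrix (f ⁻¹ₐ) ·ᵥ X j) ≋ X (j ℤ.- + n)
      back j r = begin
        (matrix (f ⁻¹ₐ) ·ᵥ X j) r      ≈⟨ matrix-apply (f ⁻¹ₐ) (X j) r ⟩
        from f (X j) r                 ≈⟨ from-cong f (λ s → trans
          (reflexive (≡.cong (λ i → X i s) (ℤS.solve 2 (λ j n → j ℤS.:= j ℤS.:- n ℤS.:+ n) ≡.refl j (+ n))))
          (X-qp (j ℤ.- + n) s)) r ⟩
        from f (to f (X (j ℤ.- + n))) r ≈⟨ from-to f _ r ⟩
        X (j ℤ.- + n) r                ∎
      backward : ∀ q j → iter (matrix (f ⁻¹ₐ)) q (X j) ≋ X (j ℤ.- + q ℤ.* + n)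
      backward zero    j r = reflexive (≡.cong (λ i → X i r) (≡.sym (ℤ.+-identityʳ j)))
      backward (suc q) j r = begin
        (matrix (f ⁻¹ₐ) ·ᵥ iter (matrix (f ⁻¹ₐ)) q (X j)) r
          ≈⟨ ·ᵥ-cong (matrix (f ⁻¹ₐ)) (backward q j) r ⟩
        (matrix (f ⁻¹ₐ) ·ᵥ X (j ℤ.- + q ℤ.* + n)) r
          ≈⟨ back _ r ⟩
        X (j ℤ.- + q ℤ.* + n ℤ.- + n) r
          ≈⟨ reflexive (≡.cong (λ i → X i r) (ℤS.solve 3 (λ j q n →
               j ℤS.:- q ℤS.:* n ℤS.:- n ℤS.:= j ℤS.:- (ℤS.con ℤ.1ℤ ℤS.:+ q) ℤS.:* n) ≡.refl j (+ q) (+ n))) ⟩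
        X (j ℤ.- + suc q ℤ.* + n) r ∎
      powAct-shift : ∀ q j → powAct p q (X j) ≋ X (j ℤ.+ q ℤ.* + n)
      powAct-shift (+ q)    j   = forward q j
      powAct-shift -[1+ q ] j r = trans (backward (suc q) j r) (reflexive (≡.cong (λ i → X (j ℤ.+ i) r)
        (ℤ.neg-distribˡ-* (+ suc q) (+ n))))

  -- Two-sided orbits of a sequence of steps

  module _ {k : ℕ} (base : Aut k) (step : ℤ → Aut k) where
    -- The solution of f_{i+1} = f_i ∘ step_i with f_0 = `base`. Steps act on the right because they
    -- change coordinates within the moving frame.
    orbit : ℤ → Aut k
    orbit (+ zero)     = base
    orbit (+ suc q)    = orbit (+ q) ∘ₐ step (+ q)
    orbit -[1+ zero ]  = base ∘ₐ step -[1+ 0 ] ⁻¹ₐ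
    orbit -[1+ suc q ] = orbit -[1+ q ] ∘ₐ step -[1+ suc q ] ⁻¹ₐ

    orbit-suc : ∀ i u → to (orbit (ℤ.suc i)) u ≋ to (orbit i) (to (step i) u)
    orbit-suc (+ q)        u r = refl
    orbit-suc -[1+ zero ]  u r = to-cong base (λ s → sym (from-to (step -[1+ 0 ]) u s)) r
    orbit-suc -[1+ suc q ] u r =
      to-cong (orbit -[1+ q ]) (λ s → sym (from-to (step -[1+ suc q ]) u s)) r

    orbit-pred : ∀ i u → to (orbit i) u ≋ to (orbit (ℤ.suc i)) (from (step i) u)
    orbit-pred i u r = sym (trans (orbit-suc i _ r) (to-cong (orbit i) (to-from (step i) u) r))

    -- Both sides agree at 0 and satisfy the same recursion: the steps act on the right, so they do
    -- not disturb the constant left factor.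
    orbit-periodic : ∀ n → (∀ i → step (i ℤ.+ + n) ≡ step i) → ∀ i u →
                     to (orbit (i ℤ.+ + n)) u ≋ to (orbit (+ n)) (from base (to (orbit i) u))
    orbit-periodic n step-periodic = ℤ-induction _
      (λ u r → to-cong (orbit (+ n)) (λ s → sym (from-to base u s)) r)
      (λ i hyp u r → begin
        to (orbit (ℤ.suc i ℤ.+ + n)) u r
          ≈⟨ reflexive (≡.cong (λ j → to (orbit j) u r) (ℤ.+-assoc ℤ.1ℤ i (+ n))) ⟩
        to (orbit (ℤ.suc (i ℤ.+ + n))) u r
          ≈⟨ orbit-suc (i ℤ.+ + n) u r ⟩
        to (orbit (i ℤ.+ + n)) (to (step (i ℤ.+ + n)) u) r
          ≈⟨ reflexive (≡.cong (λ f → to (orbit (i ℤ.+ + n)) (to f u) r) (step-periodic i)) ⟩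
        to (orbit (i ℤ.+ + n)) (to (step i) u) r
          ≈⟨ hyp (to (step i) u) r ⟩
        to (orbit (+ n)) (from base (to (orbit i) (to (step i) u))) r
          ≈⟨ to-cong (orbit (+ n)) (from-cong base (λ s → sym (orbit-suc i u s))) r ⟩
        to (orbit (+ n)) (from base (to (orbit (ℤ.suc i)) u)) r ∎)
      (λ i hyp u r → begin
        to (orbit (i ℤ.+ + n)) u r
          ≈⟨ orbit-pred (i ℤ.+ + n) u r ⟩
        to (orbit (ℤ.suc (i ℤ.+ + n))) (from (step (i ℤ.+ + n)) u) r
          ≈⟨ reflexive (≡.cong₂ (λ j f → to (orbit j) (from f u) r)
               (≡.sym (ℤ.+-assoc ℤ.1ℤ i (+ n))) (step-periodic i)) ⟩
        to (orbit (ℤ.suc i ℤ.+ + n)) (from (step i) u) r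
          ≈⟨ hyp (from (step i) u) r ⟩
        to (orbit (+ n)) (from base (to (orbit (ℤ.suc i)) (from (step i) u))) r
          ≈⟨ to-cong (orbit (+ n)) (from-cong base (λ s → sym (orbit-pred i u s))) r ⟩
        to (orbit (+ n)) (from base (to (orbit i) u)) r ∎)

  -- Brackets relative to a frame, and telescoping ratios

  bracket-from : ∀ {k δ} (f : Aut k) → ScalesBy δ (to f) → ∀ u → bracket k u ≈ δ * bracket k (from f ∘ u)
  bracket-from {k} f f-scales u = trans
    (bracket-cong k {u} {to f ∘ from f ∘ u} (λ j r → sym (to-from f (u j) r)))
    (f-scales (from f ∘ u))

  ⁻¹-scales : ∀ {k} (f : Aut k) → ScalesBy 1# (to f) → ScalesBy 1# (from f)
  ⁻¹-scales f f-scales u = sym (trans (*-identityˡ _) (trans (bracket-from f f-scales u) (*-identityˡ _)))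

  Low-cong : ∀ {k b κ κ′} {u : Vect k} → κ ≈ κ′ → Low b κ u → Low b κ′ u
  Low-cong κ≈ low r = (λ e → trans (proj₁ (low r) e) κ≈) , proj₂ (low r)

  bracket-frame : ∀ k α κ δ (f : Aut k) → ScalesBy δ (to f) → (u : Fin k → Vect k) → α ≤ k →
    (∀ j → toℕ j ℕ.< α → ∃ λ p → Up (toℕ j) p × u j ≋ to f p) →
    (∀ j b → toℕ j ≡ α ℕ.+ b → ∃ λ p → Low b (sign b (κ b)) p × u j ≋ to f p) →
    bracket k u ≈ δ * prod κ (k ℕ.∸ α)
  bracket-frame k α κ δ f f-scales u α≤k up low = trans (bracket-from f f-scales u) (*-congˡ
    (bracket-block k α κ (from f ∘ u) α≤k
      (λ j j<α r → let p , p-up , u≋ = up j j<α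
                       e = trans (from-cong f u≋ r) (from-to f p r)
                   in (λ x → trans e (proj₁ (p-up r) x)) , λ x → trans e (proj₂ (p-up r) x))
      (λ j b j≡ r → let p , p-low , u≋ = low j b j≡
                        e = trans (from-cong f u≋ r) (from-to f p r)
                    in (λ x → trans e (proj₁ (p-low r) x)) , λ x → trans e (proj₂ (p-low r) x))))

  cancel-right : ∀ x y z (q : Unit) → x * (z * val q) ≈ y * val q → x * z ≈ y
  cancel-right x y z q eq = begin
    x * z                        ≈⟨ sym (trans (*-congˡ (val*inv q)) (*-identityʳ _)) ⟩
    (x * z) * (val q * inv q)    ≈⟨ solve 4 (λ x z q r → (x :* z) :* (q :* r) := (x :* (z :* q)) :* r) refl _ _ _ _ ⟩
    (x * (z * val q)) * inv q    ≈⟨ *-congʳ eq ⟩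
    (y * val q) * inv q          ≈⟨ trans (*-assoc _ _ _) (trans (*-congˡ (val*inv q)) (*-identityʳ _)) ⟩
    y                            ∎

  ⊘-cancel : ∀ s t → val (s ⊘ t) * val t ≈ val s
  ⊘-cancel s t = begin
    (val s * inv t) * val t  ≈⟨ trans (*-assoc _ _ _) (*-congˡ (*-comm _ _)) ⟩
    val s * (val t * inv t)  ≈⟨ trans (*-congˡ (val*inv t)) (*-identityʳ _) ⟩
    val s                    ∎

  -- If `f b` is the bracket with b vectors w, this quotient is, up to sign, the leading coefficient
  -- that the next w contributes.
  ratio : (ℕ → Unit) → ℕ → Unit
  ratio f b = f (suc b) ⊘ f b

  prod-ratio : ∀ f b → val (f 0) * prod (val ∘ ratio f) b ≈ val (f b)
  prod-ratio f zero    = *-identityʳ _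
  prod-ratio f (suc b) = begin
    val (f 0) * (val (ratio f b) * prod (val ∘ ratio f) b)
      ≈⟨ solve 3 (λ x y z → x :* (y :* z) := y :* (x :* z)) refl _ _ _ ⟩
    val (ratio f b) * (val (f 0) * prod (val ∘ ratio f) b)
      ≈⟨ *-congˡ (prod-ratio f b) ⟩
    val (ratio f b) * val (f b)
      ≈⟨ ⊘-cancel (f (suc b)) (f b) ⟩
    val (f (suc b)) ∎

  -- The cross-multiplied form of the telescoped product (f b / f 0) / (g b / g 0).
  prod-ratio-⊘ : ∀ f g b → val (f 0) * (prod (λ b → val (ratio f b ⊘ ratio g b)) b * val (g b)) ≈
                            val (g 0) * val (f b)
  prod-ratio-⊘ f g zero    = solve 2 (λ x y → x :* (con 1 :* y) := y :* x) refl _ _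
  prod-ratio-⊘ f g (suc b) = begin
    val (f 0) * (((f′ * inv (f b)) * (inv (g (suc b)) * g₀) * P) * g′)
      ≈⟨ solve 7 (λ f0 f′ f⁻ g⁻ g₀ P g′ → f0 :* (((f′ :* f⁻) :* (g⁻ :* g₀) :* P) :* g′) :=
           (f′ :* f⁻) :* (f0 :* (P :* g₀)) :* (g′ :* g⁻)) refl _ _ _ _ _ _ _ ⟩
    (f′ * inv (f b)) * (val (f 0) * (P * g₀)) * (g′ * inv (g (suc b)))
      ≈⟨ *-cong (*-congˡ (prod-ratio-⊘ f g b)) (val*inv (g (suc b))) ⟩
    (f′ * inv (f b)) * (val (g 0) * val (f b)) * 1#
      ≈⟨ solve 4 (λ f′ f⁻ g f → (f′ :* f⁻) :* (g :* f) :* con 1 := g :* ((f′ :* f⁻) :* f)) refl _ _ _ _ ⟩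
    val (g 0) * ((f′ * inv (f b)) * val (f b))
      ≈⟨ *-congˡ (⊘-cancel (f (suc b)) (f b)) ⟩
    val (g 0) * f′ ∎
    where
    f′ = val (f (suc b))
    g₀ = val (g b)
    g′ = val (g (suc b))
    P = prod (λ b → val (ratio f b ⊘ ratio g b)) b

  -- The sequence of frames

  -- C i β and D i β are the values to be taken by the brackets of types (c) and (d)
  -- with β vectors w (so α = k ∸ β).  β = 0 is type (a); β = k is type (b), with index
  -- i for C and i − 1 for D.
  module Frames (m n : ℕ) (C D : ℤ → ℕ → Unit)
    (C-periodic : ∀ i → C (i ℤ.+ + n) ≡ C i) (D-periodic : ∀ i → D (i ℤ.+ + n) ≡ D i)
    (C₀≡D₀ : ∀ i → C i 0 ≡ D i 0) (Cₖ≡Dₖ : ∀ i → C i (suc m) ≡ D (ℤ.suc i) (suc m)) where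

    k : ℕ
    k = suc m

    -- In the frames E′ i and E (suc i), the vector w_{i-b} has the leading coefficients
    -- ± ratio (C i) b and ± ratio (D (suc i)) b; these entries turn one into the next.
    diagonal : (ℕ → Unit) → (ℕ → Unit) → ℕ → Unit
    diagonal c d b = ratio c b ⊘ ratio d b

    superdiagonal : (ℕ → Unit) → (ℕ → Unit) → ℕ → K
    superdiagonal c d b = - val (ratio c (suc b) ⊘ ratio d b)

    x : ℤ → ℕ → Unit
    x i = diagonal (C i) (D (ℤ.suc i))

    y : ℤ → ℕ → K
    y i = superdiagonal (C i) (D i)

    step : ℤ → Aut k
    step i = upperₐ k (y i) ⁻¹ₐ ∘ₐ lowerₐ k (x i)

    E E′ : ℤ → Aut k
    -- The initial frame has to have the determinant prescribed for the bracket of v_0, ..., v_m; a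
    -- diagonal one suffices.
    E    = orbit (scaleFirstₐ (C (+ 0) 0)) step
    E′ i = E i ∘ₐ upperₐ k (y i) ⁻¹ₐ

    E-suc : ∀ i u → to (E (ℤ.suc i)) u ≋ to (E′ i) (to (lowerₐ k (x i)) u)
    E-suc = orbit-suc _ step

    -- F_i starts with the line of v_i and G_i with that of w_i, so these are the first and the last
    -- vector of the frame E′_i up to scale. The scalar of w_i is its leading coefficient at b = 0.
    V W : ℤ → Vect k
    V i = to (E′ i) (basis zero)
    W i = to (E′ i) (λ r → val (ratio (C i) 0) * basis (Fin.fromℕ m) r)

    step-scales : ∀ i → ScalesBy (prod (val ∘ x i) k) (to (step i))
    step-scales i = ScalesBy-≈ (step i) (*-identityˡ _)
      (ScalesBy-∘ (upperₐ k (y i) ⁻¹ₐ) (lowerₐ k (x i))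
        (⁻¹-scales (upperₐ k (y i)) (upper-scales k (y i))) (lower-scales k (x i)))

    -- The determinant of the step telescopes to a quotient of end values. Those at `k` cancel,
    -- since both prescribe the bracket of w_i, ..., w_{i-m}; those at 0 are consecutive values of
    -- type (a).
    step-ratio : ∀ i → val (C i 0) * prod (val ∘ x i) k ≈ val (C (ℤ.suc i) 0)
    step-ratio i = trans
      (cancel-right (val (C i 0)) (val (D (ℤ.suc i) 0)) _ (C i k)
        (trans (*-congˡ (*-congˡ (reflexive (≡.cong val (Cₖ≡Dₖ i)))))
               (prod-ratio-⊘ (C i) (D (ℤ.suc i)) k)))
      (reflexive (≡.cong val (≡.sym (C₀≡D₀ (ℤ.suc i)))))

    E-scales : ∀ i → ScalesBy (val (C i 0)) (to (E i))
    E-scales = ℤ-induction _ (scaleFirst-scales _)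
      (λ i hyp u → begin
        bracket k (to (E (ℤ.suc i)) ∘ u)
          ≈⟨ bracket-cong k {to (E (ℤ.suc i)) ∘ u} {to (E i) ∘ to (step i) ∘ u} (λ j → E-suc i (u j)) ⟩
        bracket k (to (E i) ∘ to (step i) ∘ u)
          ≈⟨ ScalesBy-∘ (E i) (step i) hyp (step-scales i) u ⟩
        val (C i 0) * prod (val ∘ x i) k * bracket k u
          ≈⟨ *-congʳ (step-ratio i) ⟩
        val (C (ℤ.suc i) 0) * bracket k u ∎)
      (λ i hyp u → begin
        bracket k (to (E i) ∘ u)
          ≈⟨ bracket-cong k {to (E i) ∘ u} {to (E (ℤ.suc i)) ∘ from (step i) ∘ u} (λ j → orbit-pred _ step i (u j)) ⟩
        bracket k (to (E (ℤ.suc i)) ∘ from (step i) ∘ u)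
          ≈⟨ hyp (from (step i) ∘ u) ⟩
        val (C (ℤ.suc i) 0) * bracket k (from (step i) ∘ u)
          ≈⟨ *-congʳ (sym (step-ratio i)) ⟩
        val (C i 0) * prod (val ∘ x i) k * bracket k (from (step i) ∘ u)
          ≈⟨ trans (*-assoc _ _ _) (*-congˡ (sym (bracket-from (step i) (step-scales i) u))) ⟩
        val (C i 0) * bracket k u ∎)

    E′-scales : ∀ i → ScalesBy (val (C i 0)) (to (E′ i))
    E′-scales i = ScalesBy-≈ (E′ i) (*-identityʳ _) (ScalesBy-∘ (E i) (upperₐ k (y i) ⁻¹ₐ)
      (E-scales i) (⁻¹-scales (upperₐ k (y i)) (upper-scales k (y i))))

    monodromy : Aut k
    monodromy = E (+ n) ∘ₐ E (+ 0) ⁻¹ₐ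

    -- E_n and E_0 have the same determinant because `C` is periodic; this puts A in SL(V).
    monodromy-scales : ScalesBy 1# (to monodromy)
    monodromy-scales u = begin
      bracket k (to (E (+ n)) ∘ from (E (+ 0)) ∘ u)
        ≈⟨ E-scales (+ n) (from (E (+ 0)) ∘ u) ⟩
      val (C (+ n) 0) * bracket k (from (E (+ 0)) ∘ u)
        ≈⟨ *-congʳ (reflexive (≡.cong (λ c → val (c 0)) (C-periodic (+ 0)))) ⟩
      val (C (+ 0) 0) * bracket k (from (E (+ 0)) ∘ u)
        ≈⟨ sym (bracket-from (E (+ 0)) (E-scales (+ 0)) u) ⟩
      bracket k u
        ≈⟨ sym (*-identityˡ _) ⟩
      1# * bracket k u ∎

    y-periodic : ∀ i → y (i ℤ.+ + n) ≡ y i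
    y-periodic i = ≡.cong₂ superdiagonal (C-periodic i) (D-periodic i)

    x-periodic : ∀ i → x (i ℤ.+ + n) ≡ x i
    x-periodic i = ≡.cong₂ diagonal (C-periodic i) D-suc-periodic
      where
      D-suc-periodic : D (ℤ.suc (i ℤ.+ + n)) ≡ D (ℤ.suc i)
      D-suc-periodic = ≡.trans (≡.cong D (≡.sym (ℤ.+-assoc ℤ.1ℤ i (+ n)))) (D-periodic (ℤ.suc i))

    E-periodic : ∀ i u → to (E (i ℤ.+ + n)) u ≋ to monodromy (to (E i) u)
    E-periodic = orbit-periodic _ step n λ i →
      ≡.cong₂ (λ y x → upperₐ k y ⁻¹ₐ ∘ₐ lowerₐ k x) (y-periodic i) (x-periodic i)

    E′-periodic : ∀ i u → to (E′ (i ℤ.+ + n)) u ≋ to monodromy (to (E′ i) u)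
    E′-periodic i u r = trans
      (reflexive (≡.cong (λ y → to (E (i ℤ.+ + n)) (from (upperₐ k y) u) r) (y-periodic i)))
      (E-periodic i (from (upperₐ k (y i)) u) r)

    V-periodic : ∀ i → V (i ℤ.+ + n) ≋ to monodromy (V i)
    V-periodic i = E′-periodic i (basis zero)

    W-periodic : ∀ i → W (i ℤ.+ + n) ≋ to monodromy (W i)
    W-periodic i r = trans
      (reflexive (≡.cong (λ c → to (E′ (i ℤ.+ + n)) (λ r → val (ratio c 0) * basis (Fin.fromℕ m) r) r) (C-periodic i)))
      (E′-periodic i _ r)

    -- The coordinates travel from E′_{i+1} to E_{i+1} through U⁻¹, which keeps the leading
    -- position, and on to E′_i through L, which lowers it by one row.
    V-up : ∀ a i → ∃ λ p → Up a p × V (i ℤ.+ + a) ≋ to (E′ i) p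
    V-up zero    i = basis zero , basis-Up {k} zero ,
      λ r → reflexive (≡.cong (λ j → V j r) (ℤ.+-identityʳ i))
    V-up (suc a) i =
      let p , p-up , V≋ = V-up a (ℤ.suc i)
          p′ = from (upperₐ k (y (ℤ.suc i))) p
      in to (lowerₐ k (x i)) p′
       , lower-to-Up k (x i) a (upper-from-Up k (y (ℤ.suc i)) a p-up)
       , λ r → trans (reflexive (≡.cong (λ j → V j r) (ℤS.solve 2 (λ i a →
                 i ℤS.:+ (ℤS.con ℤ.1ℤ ℤS.:+ a) ℤS.:= (ℤS.con ℤ.1ℤ ℤS.:+ i) ℤS.:+ a) ≡.refl i (+ a))))
               (trans (V≋ r) (E-suc i p′ r))

    V-up-E : ∀ a i → ∃ λ p → Up a p × V (i ℤ.+ + a) ≋ to (E i) p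
    V-up-E a i = let p , p-up , V≋ = V-up a i
      in from (upperₐ k (y i)) p , upper-from-Up k (y i) a p-up , V≋

    -- The vectors w travel the opposite way: from E′_i to E_{i+1} through L⁻¹, which keeps the
    -- leading position and divides by a diagonal entry, then to E′_{i+1} through U, which raises it
    -- by one row. The minus sign in the superdiagonal produces the alternation `sign b`.
    W-low : ∀ b i → ∃ λ q → Low b (sign b (val (ratio (C i) b))) q × W (i ℤ.- + b) ≋ to (E′ i) q

    W-low-E : ∀ b i → ∃ λ q → Low b (sign b (val (ratio (D (ℤ.suc i)) b))) q × W (i ℤ.- + b) ≋ to (E (ℤ.suc i)) q
    W-low-E b i =
      let q , q-low , W≋ = W-low b i
      in from (lowerₐ k (x i)) q
       , Low-cong {k} (ν b (ratio (C i) b) (ratio (D (ℤ.suc i)) b)) (lower-from-Low k (x i) b q-low)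
       , λ r → trans (W≋ r) (trans (to-cong (E′ i) (λ s → sym (to-from (lowerₐ k (x i)) q s)) r)
           (sym (E-suc i _ r)))
      where
      ν : ∀ b s t → inv (s ⊘ t) * sign b (val s) ≈ sign b (val t)
      ν b s t = trans (sym (sign-*ʳ b _ _)) (sign-cong b (begin
        (inv s * val t) * val s  ≈⟨ solve 3 (λ s⁻ t s → (s⁻ :* t) :* s := t :* (s :* s⁻)) refl _ _ _ ⟩
        val t * (val s * inv s)  ≈⟨ trans (*-congˡ (val*inv s)) (*-identityʳ _) ⟩
        val t                    ∎))

    W-low zero    i = _ , low , λ r → reflexive (≡.cong (λ j → W j r) (ℤ.+-identityʳ i))
      where
      low : Low 0 (val (ratio (C i) 0)) (λ r → val (ratio (C i) 0) * basis (Fin.fromℕ m) r)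
      low r =
        (λ e → trans (*-congˡ (proj₁ (basis-Up (Fin.fromℕ m) r)
          (≡.trans (ℕ.suc-injective (≡.trans (ℕ.+-comm 1 (toℕ r)) e)) (≡.sym (toℕ-fromℕ m))))) (*-identityʳ _))
        , λ lt → trans (*-congˡ (basis-off-diagonal (Fin.fromℕ m) r
            λ e → ℕ.<⇒≢ lt (≡.trans (ℕ.+-comm (toℕ r) 1)
              (≡.cong suc (≡.trans (≡.sym e) (toℕ-fromℕ m)))))) (zeroʳ _)
    -- The passage goes from `pred i` forward to `i`; it is carried out at an index of the form
    -- `suc i`, to which `E-suc` applies, and then transported.
    W-low (suc b) i = ≡.subst
      (λ i → ∃ λ q → Low (suc b) (sign (suc b) (val (ratio (C i) (suc b)))) q × W (i ℤ.- + suc b) ≋ to (E′ i) q)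
      (ℤ.suc-pred i) (next (ℤ.pred i))
      where
      next : ∀ i → ∃ λ q → Low (suc b) (sign (suc b) (val (ratio (C (ℤ.suc i)) (suc b)))) q ×
                           W (ℤ.suc i ℤ.- + suc b) ≋ to (E′ (ℤ.suc i)) q
      next i =
        let q , q-low , W≋ = W-low-E b i
            U = upperₐ k (y (ℤ.suc i))
        in to U q
         , Low-cong {k} (μ b (ratio (C (ℤ.suc i)) (suc b)) (ratio (D (ℤ.suc i)) b)) (upper-to-Low k (y (ℤ.suc i)) b q-low)
         , λ r → trans (reflexive (≡.cong (λ j → W j r) (ℤS.solve 2 (λ i b →
                   (ℤS.con ℤ.1ℤ ℤS.:+ i) ℤS.:- (ℤS.con ℤ.1ℤ ℤS.:+ b) ℤS.:= i ℤS.:- b) ≡.refl i (+ b))))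
                 (trans (W≋ r) (to-cong (E (ℤ.suc i)) (λ s → sym (from-to U q s)) r))
        where
        μ : ∀ b s t → - val (s ⊘ t) * sign b (val t) ≈ - sign b (val s)
        μ b s t = trans (sym (-‿distribˡ-* _ _)) (-‿cong
          (trans (sym (sign-*ʳ b _ _)) (sign-cong b (⊘-cancel s t))))

    bracket-C : ∀ i α (u : Fin k → Vect k) → α ≤ k →
      (∀ j → toℕ j ℕ.< α → u j ≋ V (i ℤ.+ + toℕ j)) →
      (∀ j b → toℕ j ≡ α ℕ.+ b → u j ≋ W (i ℤ.- + b)) →
      bracket k u ≈ val (C i (k ℕ.∸ α))
    bracket-C i α u α≤k u≋V u≋W = trans
      (bracket-frame k α (val ∘ ratio (C i)) (val (C i 0)) (E′ i) (E′-scales i) u α≤k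
        (λ j j<α → let p , p-up , V≋ = V-up (toℕ j) i in p , p-up , λ r → trans (u≋V j j<α r) (V≋ r))
        (λ j b e → let q , q-low , W≋ = W-low b i in q , q-low , λ r → trans (u≋W j b e r) (W≋ r)))
      (prod-ratio (C i) (k ℕ.∸ α))

    -- Here the v start one index after the w, so the frame is E_{i+1}, adapted to F_{i+1} and G_i.
    -- As in `bracket-C`, its determinant times the leading coefficients telescopes to the
    -- prescribed value.
    bracket-D : ∀ i α (u : Fin k → Vect k) → α ≤ k →
      (∀ j → toℕ j ℕ.< α → u j ≋ V (ℤ.suc i ℤ.+ + toℕ j)) →
      (∀ j b → toℕ j ≡ α ℕ.+ b → u j ≋ W (i ℤ.- + b)) →
      bracket k u ≈ val (D (ℤ.suc i) (k ℕ.∸ α))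
    bracket-D i α u α≤k u≋V u≋W = trans
      (bracket-frame k α (val ∘ ratio (D (ℤ.suc i))) (val (D (ℤ.suc i) 0)) (E (ℤ.suc i))
        (ScalesBy-≈ (E (ℤ.suc i)) (reflexive (≡.cong val (C₀≡D₀ (ℤ.suc i)))) (E-scales (ℤ.suc i))) u α≤k
        (λ j j<α → let p , p-up , V≋ = V-up-E (toℕ j) (ℤ.suc i) in p , p-up , λ r → trans (u≋V j j<α r) (V≋ r))
        (λ j b e → let q , q-low , W≋ = W-low-E b i in q , q-low , λ r → trans (u≋W j b e r) (W≋ r)))
      (prod-ratio (D (ℤ.suc i)) (k ℕ.∸ α))

  -- Polynomials vanishing on positive integers

  horner : List K → K → K
  horner []       z = 0#
  horner (q ∷ qs) z = q + z * horner qs z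

  -- The coefficients of (p(z) − p(s)) / (z − s) for p = q ∷ qs, as a function of s and qs.
  quotient : K → List K → List K
  quotient s []       = []
  quotient s (q ∷ qs) = horner (q ∷ qs) s ∷ quotient s qs

  length-quotient : ∀ s qs → length (quotient s qs) ≡ length qs
  length-quotient s []       = ≡.refl
  length-quotient s (q ∷ qs) = ≡.cong suc (length-quotient s qs)

  -- p(z) − p(s) = (z − s) Q(z), with both sides moved so that no subtraction occurs.
  horner-quotient : ∀ s z q qs → horner (q ∷ qs) z + s * horner (quotient s qs) z ≈
                                 horner (q ∷ qs) s + z * horner (quotient s qs) z
  horner-quotient s z q [] = solve 3 (λ s z q →
    (q :+ z :* con 0) :+ s :* con 0 := (q :+ s :* con 0) :+ z :* con 0) refl s z q
  horner-quotient s z q (q′ ∷ qs) = begin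
    (q + z * p z) + s * (p s + z * Q)
      ≈⟨ solve 6 (λ q z p s p′ Q → (q :+ z :* p) :+ s :* (p′ :+ z :* Q) :=
           q :+ z :* (p :+ s :* Q) :+ s :* p′) refl q z (p z) s (p s) Q ⟩
    q + z * (p z + s * Q) + s * p s
      ≈⟨ +-congʳ (+-congˡ (*-congˡ (horner-quotient s z q′ qs))) ⟩
    q + z * (p s + z * Q) + s * p s
      ≈⟨ solve 5 (λ q z s p′ Q → q :+ z :* (p′ :+ z :* Q) :+ s :* p′ :=
           (q :+ s :* p′) :+ z :* (p′ :+ z :* Q)) refl q z s (p s) Q ⟩
    (q + s * p s) + z * (p s + z * Q) ∎
    where
    p = horner (q′ ∷ qs)
    Q = horner (quotient s qs) z

  -- The entries of `quotient s qs` are the Horner values at `s` of the nonempty suffixes of `qs`;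
  -- once two consecutive ones vanish, so does the coefficient between them.
  quotient-zero : ∀ s q qs → horner (q ∷ qs) s ≈ 0# → All (_≈ 0#) (quotient s qs) → All (_≈ 0#) (q ∷ qs)
  quotient-zero s q [] root [] = trans (sym (trans (+-congˡ (zeroʳ s)) (+-identityʳ q))) root ∷ []
  quotient-zero s q (q′ ∷ qs) root (root′ ∷ zs) =
    trans (sym (trans (+-congˡ (trans (*-congˡ root′) (zeroʳ s))) (+-identityʳ q))) root
    ∷ quotient-zero s q′ qs root′ zs

  +-cancel-zero : ∀ x y → x ≈ x + y → y ≈ 0#
  +-cancel-zero x y e = begin
    y              ≈⟨ sym (trans (+-congʳ (-‿inverseˡ x)) (+-identityˡ y)) ⟩
    (- x + x) + y  ≈⟨ +-assoc _ _ _ ⟩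
    - x + (x + y)  ≈⟨ +-congˡ (sym e) ⟩
    - x + x        ≈⟨ -‿inverseˡ x ⟩
    0#             ∎

  Unit-cancel-zero : ∀ s x → val s * x ≈ 0# → x ≈ 0#
  Unit-cancel-zero s x e = begin
    x                      ≈⟨ sym (trans (*-congʳ (trans (*-comm _ _) (val*inv s))) (*-identityˡ x)) ⟩
    (inv s * val s) * x    ≈⟨ *-assoc _ _ _ ⟩
    inv s * (val s * x)    ≈⟨ trans (*-congˡ e) (zeroʳ _) ⟩
    0#                     ∎

  ℕ→K-+ : ∀ i j → ℕ→K (i ℕ.+ j) ≈ ℕ→K i + ℕ→K j
  ℕ→K-+ zero    j = sym (+-identityˡ _)
  ℕ→K-+ (suc i) j = trans (+-congˡ (ℕ→K-+ i j)) (sym (+-assoc _ _ _))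

  module _ (natUnit : ℕ → Unit) (natUnit-val : ∀ j → val (natUnit j) ≡ ℕ→K (suc j)) where

    -- Dividing by the root s + 1 leaves a shorter list, which vanishes at all later integers
    -- because their distances from s + 1 are units. `N` bounds the length, since the quotient is
    -- not a structural part of `qs`.
    coefficients-zero : ∀ N qs → length qs ≤ N → ∀ s →
      (∀ j → horner qs (ℕ→K (suc (s ℕ.+ j))) ≈ 0#) → All (_≈ 0#) qs
    coefficients-zero N       []       len s vanish = []
    coefficients-zero (suc N) (q ∷ qs) (ℕ.s≤s len) s vanish =
      quotient-zero σ q qs root
        (coefficients-zero N (quotient σ qs) (≡.subst (_≤ N) (≡.sym (length-quotient σ qs)) len) (suc s) Q-vanish)
      where
      σ = ℕ→K (suc s)
      root : horner (q ∷ qs) σ ≈ 0#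
      root = ≡.subst (λ t → horner (q ∷ qs) (ℕ→K (suc t)) ≈ 0#) (ℕ.+-identityʳ s) (vanish 0)
      Q-vanish : ∀ j → horner (quotient σ qs) (ℕ→K (suc (suc s ℕ.+ j))) ≈ 0#
      Q-vanish j = Unit-cancel-zero (natUnit j) Q (+-cancel-zero (σ * Q) (val (natUnit j) * Q) (begin
        σ * Q                        ≈⟨ sym (trans (+-congʳ p-vanish) (+-identityˡ _)) ⟩
        horner (q ∷ qs) z + σ * Q    ≈⟨ horner-quotient σ z q qs ⟩
        horner (q ∷ qs) σ + z * Q    ≈⟨ trans (+-congʳ root) (+-identityˡ _) ⟩
        z * Q                        ≈⟨ *-congʳ z≈ ⟩
        (σ + val (natUnit j)) * Q    ≈⟨ distribʳ _ _ _ ⟩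
        σ * Q + val (natUnit j) * Q  ∎))
        where
        z = ℕ→K (suc (suc s ℕ.+ j))
        Q = horner (quotient σ qs) z
        p-vanish : horner (q ∷ qs) z ≈ 0#
        p-vanish = ≡.subst (λ t → horner (q ∷ qs) (ℕ→K (suc t)) ≈ 0#) (ℕ.+-suc s j) (vanish (suc j))
        z≈ : z ≈ σ + val (natUnit j)
        z≈ = trans (reflexive (≡.cong (λ t → ℕ→K (suc t)) (≡.sym (ℕ.+-suc s j))))
          (trans (ℕ→K-+ (suc s) (suc j)) (+-congˡ (reflexive (≡.sym (natUnit-val j)))))

    evalPoly-horner : ∀ {k} (P : Poly (suc k)) z zs →
      evalPoly {suc k} P (z ∷ zs) ≡ horner (List.map (λ q → evalPoly {k} q zs) P) z
    evalPoly-horner         []       z zs = ≡.refl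
    evalPoly-horner {k = k} (q ∷ qs) z zs =
      ≡.cong (λ t → evalPoly {k} q zs + z * t) (evalPoly-horner {k} qs z zs)

    -- With the other variables fixed at units, the first one runs through the positive integers; so
    -- each coefficient vanishes on units, and induction on the number of variables applies.
    vanish-on-units : ∀ k (P : Poly k) →
      (∀ (us : Vec Unit k) → evalPoly {k} P (Vec.map val us) ≈ 0#) → IsZeroPoly {k} P
    vanish-on-units zero    P vanish = vanish []
    vanish-on-units (suc k) P vanish = coefficientwise P λ us →
      coefficients-zero _ (List.map (λ q → evalPoly {k} q (Vec.map val us)) P) ℕ.≤-refl 0 λ j →
        ≡.subst (_≈ 0#) (≡.trans (evalPoly-horner {k} P _ _)
          (≡.cong (horner (List.map (λ q → evalPoly {k} q (Vec.map val us)) P)) (natUnit-val j)))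
          (vanish (natUnit j ∷ us))
      where
      coefficientwise : ∀ (qs : List (Poly k)) →
        (∀ us → All (_≈ 0#) (List.map (λ q → evalPoly {k} q (Vec.map val us)) qs)) → IsZeroPoly {suc k} qs
      coefficientwise []       zs = lift _
      coefficientwise (q ∷ qs) zs =
        vanish-on-units k q (All.head ∘ zs) , coefficientwise qs (All.tail ∘ zs)

  evalPoly-cong : ∀ k (P : Poly k) {zs zs′ : Vec K k} → Pointwise _≈_ zs zs′ → evalPoly {k} P zs ≈ evalPoly {k} P zs′
  evalPoly-cong zero    P        []       = refl
  evalPoly-cong (suc k) []       (e ∷ es) = refl
  evalPoly-cong (suc k) (q ∷ qs) (e ∷ es) =
    +-cong (evalPoly-cong k q es) (*-cong e (evalPoly-cong (suc k) qs (e ∷ es)))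

  -- A point with prescribed values of the brackets

  if-≤ : ∀ {i j N} (u v : Vect N) → i ≤ j → (if i ℕ.≤ᵇ j then u else v) ≡ u
  if-≤ {i} {j} u v i≤j with i ℕ.≤ᵇ j | ℕ.≤⇒≤ᵇ i≤j
  ... | true | _ = ≡.refl

  if-> : ∀ {i j N} (u v : Vect N) → j ℕ.< i → (if i ℕ.≤ᵇ j then u else v) ≡ v
  if-> {i} {j} u v j<i with i ℕ.≤ᵇ j | ℕ.≤ᵇ⇒≤ i j
  ... | false | _   = ≡.refl
  ... | true  | i≤j = ⊥-elim (ℕ.<⇒≱ j<i (i≤j _))

  extendFin : ∀ {A : Set (c ⊔ ℓ)} {m} → (Fin m → A) → A → ℕ → A
  extendFin {m = zero}  f z _       = z
  extendFin {m = suc m} f z zero    = f zero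
  extendFin {m = suc m} f z (suc j) = extendFin (f ∘ suc) z j

  extendFin-toℕ : ∀ {A : Set (c ⊔ ℓ)} {m} (f : Fin m → A) z a → extendFin f z (toℕ a) ≡ f a
  extendFin-toℕ f z zero    = ≡.refl
  extendFin-toℕ f z (suc a) = extendFin-toℕ (f ∘ suc) z a

  extendFin-last : ∀ {A : Set (c ⊔ ℓ)} {m} (f : Fin m → A) z → extendFin f z m ≡ z
  extendFin-last {m = zero}  f z = ≡.refl
  extendFin-last {m = suc m} f z = extendFin-last (f ∘ suc) z

  module Realize (m n : ℕ) .{{_ : NonZero n}} (a b : Fin n → Unit) (cs ds : Fin n → Fin m → Unit) where

    -- The value prescribed to a bracket with α vectors v, from those of types (b), (c) or (d), (a).
    byAlpha : Unit → (Fin m → Unit) → Unit → ℕ → Unit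
    byAlpha b cs a zero    = b
    byAlpha b cs a (suc j) = extendFin cs a j

    C D : ℤ → ℕ → Unit
    C i β = byAlpha (b (residue n i)) (cs (residue n i)) (a (residue n i)) (suc m ℕ.∸ β)
    D i β = byAlpha (b (residue n (ℤ.pred i))) (ds (residue n i)) (a (residue n i)) (suc m ℕ.∸ β)

    -- Equality of functions on the nose, because `i` enters only through its residue; this gives
    -- equality of the steps themselves.
    C-periodic : ∀ i → C (i ℤ.+ + n) ≡ C i
    C-periodic i = ≡.cong (λ r β → byAlpha (b r) (cs r) (a r) (suc m ℕ.∸ β)) (residue-+n n i)

    D-periodic : ∀ i → D (i ℤ.+ + n) ≡ D i
    D-periodic i = ≡.cong₂ (λ q r β → byAlpha (b q) (ds r) (a r) (suc m ℕ.∸ β))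
      (≡.trans (≡.cong (residue n) (≡.sym (ℤ.+-assoc ℤ.-1ℤ i (+ n)))) (residue-+n n (ℤ.pred i)))
      (residue-+n n i)

    C₀≡D₀ : ∀ i → C i 0 ≡ D i 0
    C₀≡D₀ i = ≡.trans (extendFin-last (cs (residue n i)) _) (≡.sym (extendFin-last (ds (residue n i)) _))

    Cₖ≡Dₖ : ∀ i → C i (suc m) ≡ D (ℤ.suc i) (suc m)
    Cₖ≡Dₖ i rewrite ℕ.n∸n≡0 m = ≡.cong (b ∘ residue n) (≡.sym (ℤ.pred-suc i))

    open Frames m n C D C-periodic D-periodic C₀≡D₀ Cₖ≡Dₖ

    point : Point m n
    point = pointOf m n monodromy monodromy-scales V W

    vAt≋V : ∀ i → vAt point i ≋ V i
    vAt≋V = extend-pointOf m n monodromy monodromy-scales V W V V-periodic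

    wAt≋W : ∀ i → wAt point i ≋ W i
    wAt≋W = extend-pointOf m n monodromy monodromy-scales V W W W-periodic

    C-at : ∀ i α → α ≤ suc m → C (idx i) (suc m ℕ.∸ α) ≡ byAlpha (b i) (cs i) (a i) α
    C-at i α α≤k = ≡.cong₂ (λ r → byAlpha (b r) (cs r) (a r)) (residue-idx n i) (ℕ.m∸[m∸n]≡n α≤k)

    fa-point : ∀ i → fa m i point ≈ val (a i)
    fa-point i = trans
      (bracket-C (idx i) (suc m) (λ j → vAt point (idx i ℤ.+ + toℕ j)) ℕ.≤-refl (λ j _ → vAt≋V (idx i ℤ.+ + toℕ j))
        (λ j b e → ⊥-elim (ℕ.m+n≮m (suc m) b (≡.subst (ℕ._< suc m) e (toℕ<n j)))))
      (reflexive (≡.cong val (≡.trans (C-at i (suc m) ℕ.≤-refl) (extendFin-last (cs i) (a i)))))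

    fb-point : ∀ i → fb m i point ≈ val (b i)
    fb-point i = trans
      (bracket-C (idx i) 0 (λ j → wAt point (idx i ℤ.- + toℕ j)) ℕ.z≤n (λ _ ())
        (λ { j b ≡.refl → wAt≋W (idx i ℤ.- + toℕ j) }))
      (reflexive (≡.cong val (C-at i 0 ℕ.z≤n)))

    fc-point : ∀ i j → fc m i j point ≈ val (cs i j)
    fc-point i l = trans
      (bracket-C (idx i) (suc (toℕ l)) (λ j → if toℕ j ℕ.≤ᵇ toℕ l then v j else w j) (ℕ.s≤s (ℕ.<⇒≤ (toℕ<n l)))
        (λ { j (ℕ.s≤s j≤l) r → trans (reflexive (≡.cong (λ u → u r) (if-≤ (v j) (w j) j≤l))) (vAt≋V (idx i ℤ.+ + toℕ j) r) })
        (λ j b e r → trans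
          (reflexive (≡.trans
            (≡.cong (λ u → u r) (if-> (v j) (w j) (≡.subst (toℕ l ℕ.<_) (≡.sym e) (ℕ.s≤s (ℕ.m≤m+n (toℕ l) b)))))
            (≡.cong (λ d → wAt point (idx i ℤ.- d) r)
              (≡.trans (≡.cong (λ j → + j ℤ.- + suc (toℕ l)) e) (+[a+b]-+a≡+b (suc (toℕ l)) b)))))
          (wAt≋W (idx i ℤ.- + b) r)))
      (reflexive (≡.cong val (≡.trans (C-at i (suc (toℕ l)) (ℕ.s≤s (ℕ.<⇒≤ (toℕ<n l))))
        (extendFin-toℕ (cs i) (a i) l))))
      where
      v w : Fin (suc m) → Vect (suc m)
      v j = vAt point (idx i ℤ.+ + toℕ j)
      w j = wAt point (idx i ℤ.- (+ toℕ j ℤ.- + suc (toℕ l)))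

    fd-point : ∀ i j → fd m i j point ≈ val (ds i j)
    fd-point i l = trans
      -- `bracket-D` is indexed by the first w, here `idx i` minus 1; its `ℤ.suc (+ toℕ i)` computes
      -- to `idx i`.
      (bracket-D (+ toℕ i) (suc (toℕ l)) (λ j → if toℕ j ℕ.≤ᵇ toℕ l then v j else w j) (ℕ.s≤s (ℕ.<⇒≤ (toℕ<n l)))
        (λ { j (ℕ.s≤s j≤l) r → trans (reflexive (≡.cong (λ u → u r) (if-≤ (v j) (w j) j≤l))) (vAt≋V (idx i ℤ.+ + toℕ j) r) })
        (λ j b e r → trans
          (reflexive (≡.trans
            (≡.cong (λ u → u r) (if-> (v j) (w j) (≡.subst (toℕ l ℕ.<_) (≡.sym e) (ℕ.s≤s (ℕ.m≤m+n (toℕ l) b)))))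
            (≡.cong₂ (λ i d → wAt point (i ℤ.- d) r)
              (ℤS.solve 1 (λ i → ℤS.con ℤ.1ℤ ℤS.:+ i ℤS.:- ℤS.con ℤ.1ℤ ℤS.:= i) ≡.refl (+ toℕ i))
              (≡.trans (≡.cong (λ j → + j ℤ.- + suc (toℕ l)) e) (+[a+b]-+a≡+b (suc (toℕ l)) b)))))
          (wAt≋W (+ toℕ i ℤ.- + b) r)))
      (reflexive (≡.cong val (≡.trans
        (≡.cong₂ (λ r α → byAlpha (b (residue n (ℤ.pred (idx i)))) (ds r) (a r) α) (residue-idx n i)
          (ℕ.m∸[m∸n]≡n (ℕ.s≤s (ℕ.<⇒≤ (toℕ<n l)))))
        (extendFin-toℕ (ds i) (a i) l))))
      where
      v w : Fin (suc m) → Vect (suc m)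
      v j = vAt point (idx i ℤ.+ + toℕ j)
      w j = wAt point (idx i ℤ.- ℤ.1ℤ ℤ.- (+ toℕ j ℤ.- + suc (toℕ l)))

  -- Surjectivity onto tuples of units, and independence

  tabulate-lookup : ∀ {a b r} {A : Set a} {B : Set b} {_∼_ : A → B → Set r} {N} {f : Fin N → A} (ys : Vec B N) →
    (∀ i → f i ∼ Vec.lookup ys i) → Pointwise _∼_ (Vec.tabulate f) ys
  tabulate-lookup []       f∼ys = []
  tabulate-lookup (y ∷ ys) f∼ys = f∼ys zero ∷ tabulate-lookup ys (f∼ys ∘ suc)

  generators-surject-onto-units : ∀ m n .{{_ : NonZero n}} (us : Vec Unit _) →
    ∃ λ p → Pointwise (λ f u → f p ≈ val u) (generators m n) us
  generators-surject-onto-units m n us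
    -- The tuple is cut along the same concatenations that build `generators`.
    with as , us₁ , ≡.refl ← Vec.splitAt n us
    with bs , us₂ , ≡.refl ← Vec.splitAt n us₁
    with cs , ds , ≡.refl ← Vec.splitAt (n ℕ.* m) us₂
    with css , ≡.refl ← Vec.group n m cs
    with dss , ≡.refl ← Vec.group n m ds
    = point , Pointwise.++⁺ (tabulate-lookup as fa-point)
        (Pointwise.++⁺ (tabulate-lookup bs fb-point)
        (Pointwise.++⁺ (Pointwise.concat⁺ (tabulate-lookup css λ i → tabulate-lookup (Vec.lookup css i) (fc-point i)))
                       (Pointwise.concat⁺ (tabulate-lookup dss λ i → tabulate-lookup (Vec.lookup dss i) (fd-point i)))))
    where
    open Realize m n (Vec.lookup as) (Vec.lookup bs)
      (λ i → Vec.lookup (Vec.lookup css i)) (λ i → Vec.lookup (Vec.lookup dss i))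

  generators-independent : IsAlgClosedFieldChar0 → ∀ m n .{{_ : NonZero n}} → AlgIndependent (generators m n)
  generators-independent field₀ m n P vanish = vanish-on-units natUnit (λ _ → ≡.refl) _ P λ us →
    let p , p-values = generators-surject-onto-units m n us
    in trans (evalPoly-cong _ P (Pointwise.sym sym (Pointwise.map⁺ (λ e → e) p-values))) (vanish p)
    where
    open IsAlgClosedFieldChar0 field₀
    -- Characteristic 0 makes the positive integers nonzero, hence invertible in the field.
    natUnit : ℕ → Unit
    val (natUnit j)     = ℕ→K (suc j)
    inv (natUnit j)     = proj₁ (inverse _ (char0 j))
    val*inv (natUnit j) = proj₂ (inverse _ (char0 j))

mainTheorem4 : ∀ {c ℓ : Level} (R : CommutativeRing c ℓ) → Over.IsAlgClosedFieldChar0 R →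
    (m n : ℕ) → 1 ≤ m → (n≥1 : 1 ≤ n) →
    Over.AlgIndependent R (Over.generators R m n {{>-nonZero n≥1}})
mainTheorem4 R field₀ m n _ n≥1 = Theory.generators-independent R field₀ m n {{>-nonZero n≥1}}
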